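{- Let $n\ge 5$, $2\le i\le\lfloor n/2\rfloor$, $2\le j\le\lceil n/2\rceil$, $j\neq i$. The subgroup $\mathbf{Z}_{E_{i,j}}$ of the $n\times n\times n$ Rubik's Cube group $\mathbf{G}$ consisting of the elements that fix every facelet outside the center edge orbit $(i,j)$ is isomorphic to the alternating group $\mathcal{A}_{24}$ (both for odd and for even $n$).
   Context: The $n\times n\times n$ Rubik's Cube has faces U, D, F, B, R, L, each an $n\times n$ grid of facelets carrying stickers ($6n^2$ in total). For $1\le k\le\lfloor n/2\rfloor$, $F_k,B_k,R_k,L_k,U_k,D_k$ denote clockwise (seen from the named face) $90^\circ$ rotations of the $k$-th $n\times n\times 1$ slice counted from the named face. $\mathbf{G}$ is the subgroup of the symmetric group on the facelets generated by the facelet permutations induced by these moves. On each face index facelets by $(r,c)$, $1\le r,c\le n$ (as seen from outside). The center edge orbit $(i,j)$ is the set of 24 facelets which on each of the six faces occupy the four positions $(i,j),(j,n+1-i),(n+1-i,n+1-j),(n+1-j,i)$ (these belong to one-sticker center cubies). -}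

module Defs where

open import Data.Nat using (ℕ; zero; suc; _≤_; _∸_; _≡ᵇ_; _*_; ⌊_/2⌋)
open import Data.Fin using (Fin; toℕ; opposite; fromℕ)
open import Data.Fin as Fin using ()
open import Data.Fin.Permutation using (Permutation′; _⟨$⟩ʳ_; transpose)
open import Data.Bool using (if_then_else_)
open import Data.List using (List; []; _∷_; length)
open import Data.Product using (Σ; ∃; _×_; _,_)
open import Data.Sum using (_⊎_)
open import Function using (_∘_; id)
open import Relation.Nullary using (¬_)
open import Relation.Binary.PropositionalEquality using (_≡_; _≢_)

-- Geometry of the n×n×n cube.
-- Cubie coordinates (x , y , z) ∈ (Fin n)³ (0-based): x grows to the
-- right (R face at x = n-1), y grows upwards (U face at y = n-1), z grows
-- towards the front (F face at z = n-1).

data Face : Set where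
  U D F B R L : Face

-- A facelet: face, row r, column c.  Rows/columns are 0-based here; the
-- paper's 1-based (r,c) is (toℕ r + 1 , toℕ c + 1).  Rows run top to
-- bottom and columns left to right as seen from outside, in the standard
-- orientation: F, B, R, L seen with U on top; U seen with B on top;
-- D seen with F on top.
Facelet : ℕ → Set
Facelet n = Face × Fin n × Fin n

Pos : ℕ → Set
Pos n = Fin n × Fin n × Fin n

rotFace : Face → Face → Face
rotFace F U = R
rotFace F R = D
rotFace F D = L
rotFace F L = U
rotFace F f = f
rotFace B U = L
rotFace B L = D
rotFace B D = R
rotFace B R = U
rotFace B f = f
rotFace R U = B
rotFace R B = D
rotFace R D = F
rotFace R F = U
rotFace R f = f
rotFace L U = F
rotFace L F = D
rotFace L D = B
rotFace L B = U
rotFace L f = f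
rotFace U R = F
rotFace U F = L
rotFace U L = B
rotFace U B = R
rotFace U f = f
rotFace D F = R
rotFace D R = B
rotFace D B = L
rotFace D L = F
rotFace D f = f

-- extreme coordinates (Fin n is inhabited whenever we need them)
hi lo : {n : ℕ} → Fin n → Fin n
hi {suc m} _ = fromℕ m
lo {suc m} _ = Fin.zero

module _ {n : ℕ} where

  embed : Face → Fin n → Fin n → Pos n
  embed F r c = c , opposite r , hi r
  embed B r c = opposite c , opposite r , lo r
  embed R r c = hi r , opposite r , opposite c
  embed L r c = lo r , opposite r , c
  embed U r c = c , hi r , r
  embed D r c = c , lo r , opposite r

  project : Face → Pos n → Fin n × Fin n
  project F (x , y , z) = opposite y , x
  project B (x , y , z) = opposite y , opposite x
  project R (x , y , z) = opposite y , opposite z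
  project L (x , y , z) = opposite y , z
  project U (x , y , z) = z , x
  project D (x , y , z) = opposite z , x

  -- clockwise quarter turn, as seen from the named face, of cubie positions
  rotPos : Face → Pos n → Pos n
  rotPos F (x , y , z) = y , opposite x , z
  rotPos B (x , y , z) = opposite y , x , z
  rotPos R (x , y , z) = x , z , opposite y
  rotPos L (x , y , z) = x , opposite z , y
  rotPos U (x , y , z) = opposite z , y , x
  rotPos D (x , y , z) = z , y , opposite x

  axisCoord : Face → Pos n → Fin n
  axisCoord F (x , y , z) = z
  axisCoord B (x , y , z) = z
  axisCoord R (x , y , z) = x
  axisCoord L (x , y , z) = x
  axisCoord U (x , y , z) = y
  axisCoord D (x , y , z) = y

  -- (0-based) value of that coordinate on the k-th slice from the face
  layer : Face → ℕ → ℕ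
  layer F k = n ∸ k
  layer R k = n ∸ k
  layer U k = n ∸ k
  layer B k = k ∸ 1
  layer L k = k ∸ 1
  layer D k = k ∸ 1

record Move (n : ℕ) : Set where
  constructor mv
  field
    face : Face
    k    : ℕ
    1≤k  : 1 ≤ k
    k≤   : k ≤ ⌊ n /2⌋

applyMove : {n : ℕ} → Move n → Facelet n → Facelet n
applyMove {n} (mv X k _ _) (f , r , c) =
  if toℕ (axisCoord {n} X p) ≡ᵇ layer {n} X k
    then (rotFace X f , project {n} (rotFace X f) (rotPos {n} X p))
    else (f , r , c)
  where
    p : Pos n
    p = embed f r c

applyWord : {n : ℕ} → List (Move n) → Facelet n → Facelet n
applyWord []       = id
applyWord (m ∷ w) = applyMove m ∘ applyWord w

-- membership in the cube group G (generated by the moves; since G is a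
-- finite group, the submonoid generated by the moves is already G)
InG : (n : ℕ) → (Facelet n → Facelet n) → Set
InG n g = ∃ λ (w : List (Move n)) → ∀ x → g x ≡ applyWord w x

-- the center edge orbit (i,j), with 1-based i, j
InOrbit : (n i j : ℕ) → Facelet n → Set
InOrbit n i j (f , r , c) =
     (R' ≡ i × C' ≡ j)
  ⊎ (R' ≡ j × C' ≡ suc n ∸ i)
  ⊎ (R' ≡ suc n ∸ i × C' ≡ suc n ∸ j)
  ⊎ (R' ≡ suc n ∸ j × C' ≡ i)
  where
    R' C' : ℕ
    R' = suc (toℕ r)
    C' = suc (toℕ c)

InZ : (n i j : ℕ) → (Facelet n → Facelet n) → Set
InZ n i j g = InG n g × (∀ x → ¬ InOrbit n i j x → g x ≡ x)

Transposition : Set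
Transposition = Σ (Fin 24 × Fin 24) λ { (a , b) → a ≢ b }

applyTranspositions : List Transposition → Fin 24 → Fin 24
applyTranspositions []                  = id
applyTranspositions (((a , b) , _) ∷ ts) =
  (transpose a b ⟨$⟩ʳ_) ∘ applyTranspositions ts

IsEven : Permutation′ 24 → Set
IsEven π = ∃ λ (ts : List Transposition) →
  (∃ λ m → length ts ≡ 2 * m) × (∀ x → π ⟨$⟩ʳ x ≡ applyTranspositions ts x)

-- A group isomorphism from the subgroup {g | P g} of Sym(Facelet n)
-- (elements compared pointwise, product = composition) onto A_24.

record IsoToA24 (n : ℕ) (P : (Facelet n → Facelet n) → Set) : Set where
  field
    Ψ      : (g : Facelet n → Facelet n) → P g → Permutation′ 24
    Ψ-cong : ∀ g h (pg : P g) (ph : P h) → (∀ x → g x ≡ h x) →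
             ∀ y → Ψ g pg ⟨$⟩ʳ y ≡ Ψ h ph ⟨$⟩ʳ y
    Ψ-hom  : ∀ g h (pg : P g) (ph : P h) (pgh : P (g ∘ h)) →
             ∀ y → Ψ (g ∘ h) pgh ⟨$⟩ʳ y ≡ Ψ g pg ⟨$⟩ʳ (Ψ h ph ⟨$⟩ʳ y)
    Ψ-inj  : ∀ g h (pg : P g) (ph : P h) →
             (∀ y → Ψ g pg ⟨$⟩ʳ y ≡ Ψ h ph ⟨$⟩ʳ y) → ∀ x → g x ≡ h x
    Ψ-even : ∀ g (pg : P g) → IsEven (Ψ g pg)
    Ψ-onto : ∀ π → IsEven π →
             ∃ λ g → Σ (P g) λ pg → ∀ y → Ψ g pg ⟨$⟩ʳ y ≡ π ⟨$⟩ʳ y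

{-# OPTIONS --safe #-}
module Submission where

-- A quarter turn of a slice permutes the facelets of any orbit (r,c) like a
-- product of 4-cycles. Its parity is the sum of three terms which depend only on
-- the turned slice and on the coordinates 0, r and c. An element fixing the
-- corners and the wing edges (0,i) and (0,j) makes each of the three terms
-- vanish for (i,j), hence acts evenly on the orbit (i,j). Conversely, a
-- commutator of two slices, commuted with a face turn, is a 3-cycle in that
-- orbit fixing every other facelet, and its conjugates generate A₂₄. If j is the
-- middle of an odd n, the middle slice needed here cannot be turned, but turning
-- all other slices can replace it in a conjugation.
--
-- The facelets of an orbit are labelled by those of the orbit (2,3) of the cube
-- of side 6, which reduces these claims to finite computations.

open import Defs
open import Algebra.Bundles using (CommutativeRing)
open import Data.Bool using (Bool; true; false; not; _∧_; _xor_; if_then_else_; _∨_; T)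
open import Data.Bool.Properties using (xor-∧-commutativeRing; xor-same; xor-annihilates-not; xor-identityʳ; ∧-distribʳ-xor; ∧-distribˡ-xor; ∧-zeroʳ; xor-comm; not-involutive; if-float; if-eta; ∨-identityʳ; T-≡; ∧-identityʳ; ¬-not) renaming (_≟_ to _≟ᵇ_)
open import Data.Bool.Solver using (module xor-∧-Solver)
open import Data.Empty using (⊥-elim; ⊥)
open import Data.Fin using (Fin; toℕ; opposite; fromℕ; remQuot; combine; fromℕ<) renaming (zero to fzero; suc to fsuc)
open import Data.Fin.Patterns using (0F; 1F; 2F; 3F; 4F; 5F; 8F)
open import Data.Fin.Permutation using (Permutation′; _⟨$⟩ʳ_; _⟨$⟩ˡ_; transpose; _∘ₚ_; inverseˡ; inverseʳ) renaming (id to idₚ; _≈_ to _≈ₚ_)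
open import Data.Fin.Properties using (toℕ-injective; _≟_; all?; opposite-involutive; combine-remQuot; any?; toℕ<n; toℕ≤pred[n]; opposite-prop; toℕ-fromℕ<; remQuot-combine)
open import Data.List using (List; []; _∷_; length; _++_; allFin; filter; concatMap)
open import Data.List.Membership.Propositional using (_∈_)
open import Data.List.Membership.Propositional.Properties using (∈-allFin)
open import Data.List.Relation.Unary.All as All using (All; []; _∷_)
open import Data.List.Relation.Unary.All.Properties using (++⁺)
open import Data.List.Relation.Unary.AllPairs using ([]; _∷_)
open import Data.List.Relation.Unary.Any using (here; there)
open import Data.List.Relation.Unary.Unique.Propositional using (Unique)
open import Data.List.Relation.Unary.Unique.Propositional.Properties using (allFin⁺)
open import Data.Maybe using (Maybe; just; nothing) renaming (map to mapᵐ)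
open import Data.Nat as ℕ using (ℕ; zero; suc; _<ᵇ_; _≡ᵇ_; _≤_; _<_; _+_; _∸_; _*_; s≤s; z≤n; ⌊_/2⌋; ⌈_/2⌉; s≤s⁻¹)
open import Data.Nat.Properties using (<⇒<ᵇ; <ᵇ⇒<; <-cmp; ≡ᵇ⇒≡; ≡⇒≡ᵇ; ≤-trans; ≤-refl; ≤-reflexive; n≡⌊n+n/2⌋; ⌊n/2⌋-mono; m+[n∸m]≡n; +-monoʳ-≤; +-suc; suc-injective; ⌊n/2⌋+⌈n/2⌉≡n; ⌊n/2⌋≤⌈n/2⌉; +-comm; +-mono-≤; <-irrefl; n≤1+n; +-∸-assoc; *-suc; ⌊n/2⌋<n; ⌈n/2⌉<n; <⇒≤)
open import Data.Product using (_,_; _×_; proj₁; proj₂; ∃; Σ)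
open import Data.Product.Properties using (≡-dec; ,-injectiveˡ; ,-injectiveʳ)
open import Data.Sum using (inj₁; inj₂)
open import Data.Vec using (Vec; []; _∷_; lookup)
open import Function using (_∘_; id; Equivalence)
open import Relation.Binary using (DecidableEquality)
open import Relation.Binary.Definitions using (tri<; tri≈; tri>)
open import Relation.Binary.PropositionalEquality using (_≡_; _≢_; refl; sym; trans; cong; cong₂; subst; module ≡-Reasoning)
open import Relation.Nullary using (yes; no; Dec; does; ¬_; contradiction)
open import Relation.Nullary.Decidable using (dec-true; dec-false; map′; from-yes; _×-dec_; _→-dec_; ¬?)
open import Algebra.Properties.CommutativeMonoid.Sum (CommutativeRing.+-commutativeMonoid xor-∧-commutativeRing)
  using (sum; sum-syntax; sum-cong-≗; sum-permute; ∑-distrib-+; sum-replicate-zero)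

-- The motion of a facelet under a word depends only on which turned slices contain its row, its
-- column, 0 and the mirror images of these. A cube of side 6 is the smallest in which these six
-- coordinates can be distinct, and every other case, however degenerate, is an image of it.
-- Relative to two fixed coordinates `α` and `β` a row or column has only seven classes, so an
-- identity between words in all cubes becomes a finite check. Among the coordinates of the orbit
-- the hypotheses allow a single coincidence, `β` equal to its mirror image, which one Boolean
-- records. Membership in the group is given by positive words, whose moves reach a slice only from
-- its nearer face. Inverses are therefore written as turns from the opposite face and, where no
-- move provides these, as threefold turns; products (0 x)(0 y) of transpositions are likewise
-- assembled from 3-cycles and their squares.

-- Arithmetic modulo 2 and the sign of a permutation

xor-cancel-middle : ∀ x y z → x xor z ≡ (x xor y) xor (y xor z)
xor-cancel-middle false false z = refl
xor-cancel-middle false true false = refl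
xor-cancel-middle false true true = refl
xor-cancel-middle true false z = refl
xor-cancel-middle true true false = refl
xor-cancel-middle true true true = refl

xor-≡-false : ∀ x y → x xor y ≡ false → x ≡ y
xor-≡-false false false _ = refl
xor-≡-false true  true  _ = refl

<ᵇ-irrefl : ∀ m → (m <ᵇ m) ≡ false
<ᵇ-irrefl zero    = refl
<ᵇ-irrefl (suc m) = <ᵇ-irrefl m

module _ {n : ℕ} where

  _<ᶠ_ : Fin n → Fin n → Bool
  x <ᶠ y = toℕ x <ᵇ toℕ y

  <ᶠ-flip : ∀ {x y} → x ≢ y → y <ᶠ x ≡ not (x <ᶠ y)
  <ᶠ-flip {x} {y} x≢y with <-cmp (toℕ x) (toℕ y)
  ... | tri≈ _ e _ = ⊥-elim (x≢y (toℕ-injective e))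
  ... | tri< p _ ¬q with toℕ x <ᵇ toℕ y in e | toℕ y <ᵇ toℕ x in e′
  ...   | true  | false = refl
  ...   | false | _     = ⊥-elim (subst T e (<⇒<ᵇ p))
  ...   | true  | true  = ⊥-elim (¬q (<ᵇ⇒< _ _ (subst T (sym e′) _)))
  <ᶠ-flip {x} {y} x≢y | tri> ¬p _ q with toℕ x <ᵇ toℕ y in e | toℕ y <ᵇ toℕ x in e′
  ...   | false | true  = refl
  ...   | _     | false = ⊥-elim (subst T e′ (<⇒<ᵇ q))
  ...   | true  | true  = ⊥-elim (¬p (<ᵇ⇒< _ _ (subst T (sym e) _)))

  -- Unlike an inversion, a reversed pair makes sense for pairs in either order.
  reversed : Permutation′ n → Fin n → Fin n → Bool
  reversed π x y = ((π ⟨$⟩ʳ x) <ᶠ (π ⟨$⟩ʳ y)) xor (x <ᶠ y)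

  reversed-diag : ∀ π x → reversed π x x ≡ false
  reversed-diag π x = cong₂ _xor_ (<ᵇ-irrefl (toℕ (π ⟨$⟩ʳ x))) (<ᵇ-irrefl (toℕ x))

  -- Swapping two distinct points negates both comparisons, and the negations cancel.
  reversed-sym : ∀ π x y → reversed π x y ≡ reversed π y x
  reversed-sym π x y with x ≟ y
  ... | yes refl = refl
  ... | no x≢y = trans (sym (xor-annihilates-not ((π ⟨$⟩ʳ x) <ᶠ (π ⟨$⟩ʳ y)) (x <ᶠ y)))
                       (sym (cong₂ _xor_ (<ᶠ-flip πx≢πy) (<ᶠ-flip x≢y)))
    where
    πx≢πy : π ⟨$⟩ʳ x ≢ π ⟨$⟩ʳ y
    πx≢πy e = x≢y (trans (sym (inverseˡ π)) (trans (cong (π ⟨$⟩ˡ_) e) (inverseˡ π)))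

  reversed-∘ : ∀ π ρ x y → reversed (π ∘ₚ ρ) x y ≡ reversed ρ (π ⟨$⟩ʳ x) (π ⟨$⟩ʳ y) xor reversed π x y
  reversed-∘ π ρ x y =
    xor-cancel-middle ((π ∘ₚ ρ ⟨$⟩ʳ x) <ᶠ (π ∘ₚ ρ ⟨$⟩ʳ y)) ((π ⟨$⟩ʳ x) <ᶠ (π ⟨$⟩ʳ y)) (x <ᶠ y)

  ∑∑ : (Fin n → Fin n → Bool) → Bool
  ∑∑ f = ∑[ x < n ] ∑[ y < n ] f x y

  ∑∑-cong : ∀ {f g} → (∀ x y → f x y ≡ g x y) → ∑∑ f ≡ ∑∑ g
  ∑∑-cong f≗g = sum-cong-≗ (λ x → sum-cong-≗ (f≗g x))

  ∑∑-distrib : ∀ f g → ∑∑ (λ x y → f x y xor g x y) ≡ ∑∑ f xor ∑∑ g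
  ∑∑-distrib f g = trans (sum-cong-≗ (λ x → ∑-distrib-+ (f x) (g x)))
                         (∑-distrib-+ (λ x → sum (f x)) (λ x → sum (g x)))

  ∑∑-permute : ∀ f (π : Permutation′ n) → ∑∑ f ≡ ∑∑ (λ x y → f (π ⟨$⟩ʳ x) (π ⟨$⟩ʳ y))
  ∑∑-permute f π = trans (sum-permute (λ x → sum (f x)) π)
                         (sum-cong-≗ (λ x → sum-permute (f (π ⟨$⟩ʳ x)) π))

  -- The inversion number modulo 2, written as a sum over the two-element field so that it can be
  -- split and reindexed along a permutation.
  sgn : Permutation′ n → Bool
  sgn π = ∑∑ (λ x y → (x <ᶠ y) ∧ reversed π x y)

-- Modulo 2 the entries off the diagonal cancel in mirror pairs; the induction cancels the first row
-- against the first column.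
∑∑-sym-zero : ∀ {n} (f : Fin n → Fin n → Bool) → (∀ x → f x x ≡ false) →
              (∀ x y → f x y ≡ f y x) → ∑∑ f ≡ false
∑∑-sym-zero {zero}  f diag f-sym = refl
∑∑-sym-zero {suc n} f diag f-sym = begin
  (f 0F 0F xor row) xor ∑[ x < n ] (f (fsuc x) 0F xor sum (λ y → f (fsuc x) (fsuc y)))
    ≡⟨ cong₂ _xor_ (cong (_xor row) (diag 0F))
                    (∑-distrib-+ (λ x → f (fsuc x) 0F) (λ x → sum (λ y → f (fsuc x) (fsuc y)))) ⟩
  row xor (sum (λ x → f (fsuc x) 0F) xor ∑∑ (λ x y → f (fsuc x) (fsuc y)))
    ≡⟨ cong (row xor_) (cong₂ _xor_ (sum-cong-≗ (λ x → f-sym (fsuc x) 0F))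
         (∑∑-sym-zero (λ x y → f (fsuc x) (fsuc y)) (diag ∘ fsuc) (λ x y → f-sym (fsuc x) (fsuc y)))) ⟩
  row xor (row xor false)
    ≡⟨ cong (row xor_) (xor-identityʳ row) ⟩
  row xor row
    ≡⟨ xor-same row ⟩
  false ∎
  where
  open ≡-Reasoning
  row : Bool
  row = ∑[ y < n ] f 0F (fsuc y)

module _ {n : ℕ} where

  sgn-cong : ∀ {π ρ : Permutation′ n} → π ≈ₚ ρ → sgn π ≡ sgn ρ
  sgn-cong π≈ρ = ∑∑-cong (λ x y →
    cong (λ b → (x <ᶠ y) ∧ (b xor (x <ᶠ y))) (cong₂ _<ᶠ_ (π≈ρ x) (π≈ρ y)))

  sgn-id : sgn (idₚ {n}) ≡ false
  sgn-id = trans (∑∑-cong {n} {g = λ _ _ → false}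
                   (λ x y → trans (cong ((x <ᶠ y) ∧_) (xor-same (x <ᶠ y))) (∧-zeroʳ _)))
                 (trans (sum-cong-≗ {n} (λ x → sum-replicate-zero n)) (sum-replicate-zero n))

  -- Summing a symmetric function over the pairs x < y does not depend on the
  -- order used: two orders differ by a symmetric function, summed twice.
  sum-pairs-permute : ∀ (π : Permutation′ n) (s : Fin n → Fin n → Bool) → (∀ x y → s x y ≡ s y x) →
    ∑∑ (λ x y → (x <ᶠ y) ∧ s (π ⟨$⟩ʳ x) (π ⟨$⟩ʳ y)) ≡ ∑∑ (λ x y → (x <ᶠ y) ∧ s x y)
  sum-pairs-permute π s s-sym = sym (xor-≡-false _ _ (begin
    ∑∑ (λ x y → (x <ᶠ y) ∧ s x y) xor ∑∑ (λ x y → (x <ᶠ y) ∧ sπ x y)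
      ≡⟨ cong (_xor ∑∑ (λ x y → (x <ᶠ y) ∧ sπ x y)) (∑∑-permute (λ x y → (x <ᶠ y) ∧ s x y) π) ⟩
    ∑∑ (λ x y → ((π ⟨$⟩ʳ x) <ᶠ (π ⟨$⟩ʳ y)) ∧ sπ x y) xor ∑∑ (λ x y → (x <ᶠ y) ∧ sπ x y)
      ≡⟨ ∑∑-distrib (λ x y → ((π ⟨$⟩ʳ x) <ᶠ (π ⟨$⟩ʳ y)) ∧ sπ x y)
                    (λ x y → (x <ᶠ y) ∧ sπ x y) ⟨
    ∑∑ (λ x y → (((π ⟨$⟩ʳ x) <ᶠ (π ⟨$⟩ʳ y)) ∧ sπ x y) xor ((x <ᶠ y) ∧ sπ x y))
      ≡⟨ ∑∑-cong (λ x y → sym (∧-distribʳ-xor (sπ x y) ((π ⟨$⟩ʳ x) <ᶠ (π ⟨$⟩ʳ y)) (x <ᶠ y))) ⟩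
    ∑∑ (λ x y → reversed π x y ∧ sπ x y)
      ≡⟨ ∑∑-sym-zero (λ x y → reversed π x y ∧ sπ x y)
           (λ x → cong (_∧ sπ x x) (reversed-diag π x)) (λ x y → cong₂ _∧_ (reversed-sym π x y) (s-sym _ _)) ⟩
    false ∎))
    where
    open ≡-Reasoning
    sπ : Fin n → Fin n → Bool
    sπ x y = s (π ⟨$⟩ʳ x) (π ⟨$⟩ʳ y)

  sgn-∘ : ∀ (π ρ : Permutation′ n) → sgn (π ∘ₚ ρ) ≡ sgn ρ xor sgn π
  sgn-∘ π ρ = begin
    ∑∑ (λ x y → (x <ᶠ y) ∧ reversed (π ∘ₚ ρ) x y)
      ≡⟨ ∑∑-cong (λ x y → trans (cong ((x <ᶠ y) ∧_) (reversed-∘ π ρ x y)) (∧-distribˡ-xor (x <ᶠ y) _ _)) ⟩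
    ∑∑ (λ x y → ((x <ᶠ y) ∧ reversed ρ (π ⟨$⟩ʳ x) (π ⟨$⟩ʳ y)) xor ((x <ᶠ y) ∧ reversed π x y))
      ≡⟨ ∑∑-distrib (λ x y → (x <ᶠ y) ∧ reversed ρ (π ⟨$⟩ʳ x) (π ⟨$⟩ʳ y))
                    (λ x y → (x <ᶠ y) ∧ reversed π x y) ⟩
    ∑∑ (λ x y → (x <ᶠ y) ∧ reversed ρ (π ⟨$⟩ʳ x) (π ⟨$⟩ʳ y)) xor sgn π
      ≡⟨ cong (_xor sgn π) (sum-pairs-permute π (reversed ρ) (reversed-sym ρ)) ⟩
    sgn ρ xor sgn π ∎
    where open ≡-Reasoning

  transpose-fst : ∀ (x y : Fin n) → transpose x y ⟨$⟩ʳ x ≡ y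
  transpose-fst x y rewrite dec-true (x ≟ x) refl = refl

  transpose-snd : ∀ (x y : Fin n) → transpose x y ⟨$⟩ʳ y ≡ x
  transpose-snd x y with y ≟ x
  ... | yes y≡x = y≡x
  ... | no _ rewrite dec-true (y ≟ y) refl = refl

  transpose-other : ∀ {x y z : Fin n} → z ≢ x → z ≢ y → transpose x y ⟨$⟩ʳ z ≡ z
  transpose-other {x} {y} {z} z≢x z≢y rewrite dec-false (z ≟ x) z≢x | dec-false (z ≟ y) z≢y = refl

  transpose-conj : ∀ (π : Permutation′ n) x y z →
    transpose (π ⟨$⟩ʳ x) (π ⟨$⟩ʳ y) ⟨$⟩ʳ (π ⟨$⟩ʳ z) ≡ π ⟨$⟩ʳ (transpose x y ⟨$⟩ʳ z)
  transpose-conj π x y z with z ≟ x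
  ... | yes refl = transpose-fst (π ⟨$⟩ʳ z) (π ⟨$⟩ʳ y)
  ... | no z≢x with z ≟ y
  ...   | yes refl = transpose-snd (π ⟨$⟩ʳ x) (π ⟨$⟩ʳ z)
  ...   | no z≢y = transpose-other (z≢x ∘ inj) (z≢y ∘ inj)
    where
    inj : ∀ {u v} → π ⟨$⟩ʳ u ≡ π ⟨$⟩ʳ v → u ≡ v
    inj e = trans (sym (inverseˡ π)) (trans (cong (π ⟨$⟩ˡ_) e) (inverseˡ π))

  -- The sign takes values in a commutative group, so it is invariant under conjugation. This avoids
  -- counting the inversions of a general transposition.
  sgn-transpose-conj : ∀ (π : Permutation′ n) x y →
    sgn (transpose (π ⟨$⟩ʳ x) (π ⟨$⟩ʳ y)) ≡ sgn (transpose x y)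
  sgn-transpose-conj π x y = cancel (sgn π) (begin
    sgn t′ xor sgn π                  ≡⟨ sgn-∘ π t′ ⟨
    sgn (π ∘ₚ t′)                     ≡⟨ sgn-cong {π ∘ₚ t′} {t ∘ₚ π} (transpose-conj π x y) ⟩
    sgn (t ∘ₚ π)                      ≡⟨ sgn-∘ t π ⟩
    sgn π xor sgn t                   ≡⟨ xor-comm (sgn π) (sgn t) ⟩
    sgn t xor sgn π                   ∎)
    where
    open ≡-Reasoning
    t t′ : Permutation′ n
    t = transpose x y
    t′ = transpose (π ⟨$⟩ʳ x) (π ⟨$⟩ʳ y)
    cancel : ∀ {u v} w → u xor w ≡ v xor w → u ≡ v
    cancel {false} {false} w e = refl
    cancel {true}  {true}  w e = refl
    cancel {false} {true}  false ()
    cancel {false} {true}  true  ()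
    cancel {true}  {false} false ()
    cancel {true}  {false} true  ()

sgn-transpose : ∀ {x y : Fin 24} → x ≢ y → sgn (transpose x y) ≡ true
sgn-transpose {x} {y} x≢y = begin
  sgn (transpose x y)                          ≡⟨ cong₂ (λ u v → sgn (transpose u v)) π0≡x π1≡y ⟨
  sgn (transpose (π ⟨$⟩ʳ 0F) (π ⟨$⟩ʳ 1F))      ≡⟨ sgn-transpose-conj π 0F 1F ⟩
  sgn {24} (transpose 0F 1F)                   ≡⟨ refl ⟩
  true                                         ∎
  where
  open ≡-Reasoning
  -- `z` is chosen so that `π`, which swaps 1 and `z` and then 0 and `x`, takes 0 to `x` and 1 to
  -- `y`. Only the sign of the transposition of 0 and 1 is evaluated.
  z : Fin 24
  z = transpose 0F x ⟨$⟩ˡ y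
  π : Permutation′ 24
  π = transpose 1F z ∘ₚ transpose 0F x
  tz≡y : transpose 0F x ⟨$⟩ʳ z ≡ y
  tz≡y = inverseʳ (transpose 0F x)
  0≢z : 0F ≢ z
  0≢z e = x≢y (trans (sym (transpose-fst 0F x)) (trans (cong (transpose 0F x ⟨$⟩ʳ_) e) tz≡y))
  π0≡x : π ⟨$⟩ʳ 0F ≡ x
  π0≡x = trans (cong (transpose 0F x ⟨$⟩ʳ_) (transpose-other {x = 1F} (λ ()) 0≢z)) (transpose-fst 0F x)
  π1≡y : π ⟨$⟩ʳ 1F ≡ y
  π1≡y = trans (cong (transpose 0F x ⟨$⟩ʳ_) (transpose-fst 1F z)) tz≡y

odd : ℕ → Bool
odd zero    = false
odd (suc n) = not (odd n)

toPerm : List Transposition → Permutation′ 24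
toPerm []                   = idₚ
toPerm (((x , y) , _) ∷ ts) = toPerm ts ∘ₚ transpose x y

toPerm-apply : ∀ ts x → toPerm ts ⟨$⟩ʳ x ≡ applyTranspositions ts x
toPerm-apply []                   z = refl
toPerm-apply (((x , y) , _) ∷ ts) z = cong (transpose x y ⟨$⟩ʳ_) (toPerm-apply ts z)

sgn-toPerm : ∀ ts → sgn (toPerm ts) ≡ odd (length ts)
sgn-toPerm [] = sgn-id {24}
sgn-toPerm (((x , y) , x≢y) ∷ ts) =
  trans (sgn-∘ (toPerm ts) (transpose x y)) (cong₂ _xor_ (sgn-transpose x≢y) (sgn-toPerm ts))

-- Through this, an element that fixes an orbit yields an equation between parities of its moves.
identity-not-odd : ∀ ts → (∀ x → applyTranspositions ts x ≡ x) → odd (length ts) ≡ false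
identity-not-odd ts e = trans (sym (sgn-toPerm ts))
  (trans (sgn-cong {24} {toPerm ts} {idₚ} (λ x → trans (toPerm-apply ts x) (e x))) (sgn-id {24}))

-- Turns of sets of slices

module _ {A I : Set} where

  -- One notion for the facelets of any cube and for the 24 labels. `h` selects a set of slices,
  -- since one slice of a large cube may correspond to several of the six slices that an orbit
  -- meets.
  turnBy : (A → I) → (A → A) → (I → Bool) → A → A
  turnBy axis spin h x = if h (axis x) then spin x else x

  module _ {axis : A → I} {spin : A → A} where

    turnBy-cong : ∀ {h k} → (∀ s → h s ≡ k s) → ∀ x → turnBy axis spin h x ≡ turnBy axis spin k x
    turnBy-cong h≗k x = cong (λ b → if b then spin x else x) (h≗k (axis x))

    module _ (axis-spin : ∀ x → axis (spin x) ≡ axis x) where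

      axis-turnBy : ∀ h x → axis (turnBy axis spin h x) ≡ axis x
      axis-turnBy h x with h (axis x)
      ... | true  = axis-spin x
      ... | false = refl

      turnBy-disjoint : ∀ {h k} → (∀ s → k s ≡ true → h s ≡ false) → ∀ x →
        turnBy axis spin h (turnBy axis spin k x) ≡ turnBy axis spin (λ s → h s ∨ k s) x
      turnBy-disjoint {h} {k} disjoint x with k (axis x) in kx
      ... | true rewrite axis-spin x | disjoint (axis x) kx = refl
      ... | false with h (axis x)
      ...   | true  = refl
      ...   | false = refl

      turnBy-inverse : ∀ {axis′ spin′} → (∀ x → axis′ x ≡ axis x) → (∀ x → spin′ (spin x) ≡ x) →
        ∀ h x → turnBy axis′ spin′ h (turnBy axis spin h x) ≡ x
      turnBy-inverse axis′≗axis inverse h x with h (axis x) in hx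
      ... | true  rewrite axis′≗axis (spin x) | axis-spin x | hx = inverse x
      ... | false rewrite axis′≗axis x | hx = refl

      turnBy-cube : ∀ {axis′ spin′} → (∀ x → axis′ x ≡ axis x) → (∀ x → spin (spin (spin x)) ≡ spin′ x) →
        ∀ h x → turnBy axis spin h (turnBy axis spin h (turnBy axis spin h x)) ≡ turnBy axis′ spin′ h x
      turnBy-cube axis′≗axis cube h x rewrite axis′≗axis x with h (axis x) in hx
      ... | true  rewrite axis-spin x | hx | axis-spin (spin x) | axis-spin x | hx = cube x
      ... | false rewrite hx | hx = refl

module _ {n : ℕ} where

  spin : Face → Facelet n → Facelet n
  spin X (f , r , c) = rotFace X f , project (rotFace X f) (rotPos X (embed f r c))

  axis : Face → Facelet n → Fin n
  axis X (f , r , c) = axisCoord X (embed f r c)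

  turnOn : Face → (Fin n → Bool) → Facelet n → Facelet n
  turnOn X = turnBy (axis X) (spin X)

  turnOn-cong : ∀ X {P Q} → (∀ p → P p ≡ Q p) → ∀ x → turnOn X P x ≡ turnOn X Q x
  turnOn-cong X = turnBy-cong {axis = axis X} {spin X}

  selects : Move n → Fin n → Bool
  selects (mv X k _ _) p = toℕ p ≡ᵇ layer {n} X k

  applyMove-turnOn : ∀ m x → applyMove m x ≡ turnOn (Move.face m) (selects m) x
  applyMove-turnOn (mv X k _ _) (f , r , c) = refl

-- Maps of coordinates respecting the symmetry of the cube; the orbit of a
-- facelet in the cube of side n is the image of an orbit in the cube of side 6.
record CoordMap (m n : ℕ) : Set where
  field
    to          : Fin (suc m) → Fin (suc n)
    to-zero     : to fzero ≡ fzero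
    to-opposite : ∀ p → to (opposite p) ≡ opposite (to p)

  to-last : to (fromℕ m) ≡ fromℕ n
  to-last = trans (to-opposite fzero) (cong opposite to-zero)

  facelet : Facelet (suc m) → Facelet (suc n)
  facelet (f , r , c) = f , to r , to c

  pos : Pos (suc m) → Pos (suc n)
  pos (x , y , z) = to x , to y , to z

  private
    pos-≡ : ∀ {x y z x′ y′ z′ : Fin (suc n)} → x ≡ x′ → y ≡ y′ → z ≡ z′ →
            (x , y , z) ≡ (x′ , y′ , z′)
    pos-≡ refl refl refl = refl

  pos-embed : ∀ f r c → pos (embed f r c) ≡ embed f (to r) (to c)
  pos-embed F r c = pos-≡ refl (to-opposite r) to-last
  pos-embed B r c = pos-≡ (to-opposite c) (to-opposite r) to-zero
  pos-embed R r c = pos-≡ to-last (to-opposite r) (to-opposite c)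
  pos-embed L r c = pos-≡ to-zero (to-opposite r) refl
  pos-embed U r c = pos-≡ refl to-last refl
  pos-embed D r c = pos-≡ refl to-zero (to-opposite r)

  pos-rotPos : ∀ X p → pos (rotPos X p) ≡ rotPos X (pos p)
  pos-rotPos F (x , y , z) = pos-≡ refl (to-opposite x) refl
  pos-rotPos B (x , y , z) = pos-≡ (to-opposite y) refl refl
  pos-rotPos R (x , y , z) = pos-≡ refl refl (to-opposite y)
  pos-rotPos L (x , y , z) = pos-≡ refl (to-opposite z) refl
  pos-rotPos U (x , y , z) = pos-≡ (to-opposite z) refl refl
  pos-rotPos D (x , y , z) = pos-≡ refl refl (to-opposite x)

  facelet-project : ∀ f p → facelet (f , project f p) ≡ (f , project f (pos p))
  facelet-project F (x , y , z) = cong (F ,_) (cong₂ _,_ (to-opposite y) refl)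
  facelet-project B (x , y , z) = cong (B ,_) (cong₂ _,_ (to-opposite y) (to-opposite x))
  facelet-project R (x , y , z) = cong (R ,_) (cong₂ _,_ (to-opposite y) (to-opposite z))
  facelet-project L (x , y , z) = cong (L ,_) (cong₂ _,_ (to-opposite y) refl)
  facelet-project U (x , y , z) = refl
  facelet-project D (x , y , z) = cong (D ,_) (cong₂ _,_ (to-opposite z) refl)

  to-axisCoord : ∀ X p → to (axisCoord X p) ≡ axisCoord X (pos p)
  to-axisCoord F p = refl
  to-axisCoord B p = refl
  to-axisCoord R p = refl
  to-axisCoord L p = refl
  to-axisCoord U p = refl
  to-axisCoord D p = refl

  facelet-spin : ∀ X x → facelet (spin X x) ≡ spin X (facelet x)
  facelet-spin X (f , r , c) =
    trans (facelet-project (rotFace X f) (rotPos X (embed f r c)))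
          (cong (λ p → rotFace X f , project (rotFace X f) p)
                (trans (pos-rotPos X (embed f r c)) (cong (rotPos X) (pos-embed f r c))))

  to-axis : ∀ X x → to (axis X x) ≡ axis X (facelet x)
  to-axis X (f , r , c) = trans (to-axisCoord X (embed f r c)) (cong (axisCoord X) (pos-embed f r c))

  facelet-turnOn : ∀ X P x → facelet (turnOn X (P ∘ to) x) ≡ turnOn X P (facelet x)
  facelet-turnOn X P x rewrite sym (to-axis X x) with P (to (axis X x))
  ... | true  = facelet-spin X x
  ... | false = refl

-- Labels for the 24 facelets of an orbit

faceAt : Fin 6 → Face
faceAt 0F = U
faceAt 1F = D
faceAt 2F = F
faceAt 3F = B
faceAt 4F = R
faceAt 5F = L

faceIndex : Face → Fin 6
faceIndex U = 0F
faceIndex D = 1F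
faceIndex F = 2F
faceIndex B = 3F
faceIndex R = 4F
faceIndex L = 5F

faceAt-faceIndex : ∀ f → faceAt (faceIndex f) ≡ f
faceAt-faceIndex U = refl
faceAt-faceIndex D = refl
faceAt-faceIndex F = refl
faceAt-faceIndex B = refl
faceAt-faceIndex R = refl
faceAt-faceIndex L = refl

faceIndex-faceAt : ∀ k → faceIndex (faceAt k) ≡ k
faceIndex-faceAt = from-yes (all? λ k → faceIndex (faceAt k) ≟ k)

_≟ᶠ_ : DecidableEquality Face
f ≟ᶠ g = map′ (λ e → trans (sym (faceAt-faceIndex f)) (trans (cong faceAt e) (faceAt-faceIndex g)))
              (cong faceIndex) (faceIndex f ≟ faceIndex g)

∀Face? : {P : Face → Set} → (∀ f → Dec (P f)) → Dec (∀ f → P f)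
∀Face? {P} P? = map′ (λ h f → subst P (faceAt-faceIndex f) (h (faceIndex f))) (λ h k → h (faceAt k))
                     (all? (P? ∘ faceAt))

-- The four positions on a face, in the order in which `InOrbit` lists them.
corner : Fin 4 → Fin 6 × Fin 6
corner 0F = 1F , 2F
corner 1F = 2F , 4F
corner 2F = 4F , 3F
corner 3F = 3F , 1F

-- The orbit (2,3) of the cube of side 6, which is (1,2) in 0-based coordinates;
-- a facelet (f , r , c) of this orbit is determined by f and r.
label : Fin 24 → Facelet 6
label y = faceAt (proj₁ (remQuot {6} 4 y)) , corner (proj₂ (remQuot {6} 4 y))

unlabel : Facelet 6 → Fin 24
unlabel (f , r , _) = combine (faceIndex f) (turns r)
  where
  turns : Fin 6 → Fin 4
  turns 2F = 1F
  turns 4F = 2F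
  turns 3F = 3F
  -- Row 1 is meant here; rows 0 and 5 do not meet the orbit.
  turns _  = 0F

spinL : Face → Fin 24 → Fin 24
spinL X y = unlabel (spin X (label y))

axisL : Face → Fin 24 → Fin 6
axisL X y = axis X (label y)

turnL : Face → (Fin 6 → Bool) → Fin 24 → Fin 24
turnL X = turnBy (axisL X) (spinL X)

label-spinL : ∀ X y → label (spinL X y) ≡ spin X (label y)
label-spinL = from-yes (∀Face? λ X → all? λ y →
  ≡-dec _≟ᶠ_ (≡-dec _≟_ _≟_) (label (spinL X y)) (spin X (label y)))

axisL-spinL : ∀ X y → axisL X (spinL X y) ≡ axisL X y
axisL-spinL = from-yes (∀Face? λ X → all? λ y → axisL X (spinL X y) ≟ axisL X y)

label-turnL : ∀ X h y → label (turnL X h y) ≡ turnOn X h (label y)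
label-turnL X h y = trans (if-float label (h (axisL X y)))
                          (cong (if h (axisL X y) then_else label y) (label-spinL X y))

-- With arbitrary row and column classes, checks at these six labels cover every facelet of a cube.
faceLabel : Face → Fin 24
faceLabel f = combine {6} {4} (faceIndex f) 0F

label-faceLabel : ∀ f → label (faceLabel f) ≡ (f , 1F , 2F)
label-faceLabel U = refl
label-faceLabel D = refl
label-faceLabel F = refl
label-faceLabel B = refl
label-faceLabel R = refl
label-faceLabel L = refl

-- Turns as products of transpositions

transposition : Fin 24 → Fin 24 → List Transposition
transposition x y with x ≟ y
... | yes _  = []
... | no x≢y = ((x , y) , x≢y) ∷ []

-- Each slice contains exactly four labels and the turn permutes them in one 4-cycle, so it suffices
-- to follow the first of them.
quarterTurn : Face → Fin 6 → List Transposition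
quarterTurn X s = go (filter (λ y → axisL X y ≟ s) (allFin 24))
  where
  go : List (Fin 24) → List Transposition
  go []       = []
  -- The last transposition acts first, so the product takes `y` to `y′`, `y′` to `y″`, `y″` to the
  -- fourth label and that one back to `y`.
  go (y ∷ _) = transposition y y′ ++ transposition y′ y″ ++ transposition y″ (spinL X y″)
    where
    y′ y″ : Fin 24
    y′ = spinL X y
    y″ = spinL X y′

quarterTurn-apply : ∀ X s y → applyTranspositions (quarterTurn X s) y ≡ turnL X (λ t → does (t ≟ s)) y
quarterTurn-apply = from-yes (∀Face? λ X → all? λ s → all? λ y →
  applyTranspositions (quarterTurn X s) y ≟ turnL X (λ t → does (t ≟ s)) y)

-- Besides giving the parity, the value 3 excludes the empty lists of `transposition` and `go`.
quarterTurn-length : ∀ X s → length (quarterTurn X s) ≡ 3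
quarterTurn-length = from-yes (∀Face? λ X → all? λ s → length (quarterTurn X s) ℕ.≟ 3)

applyTranspositions-++ : ∀ ts us y →
  applyTranspositions (ts ++ us) y ≡ applyTranspositions ts (applyTranspositions us y)
applyTranspositions-++ []       us y = refl
applyTranspositions-++ (t ∷ ts) us y = cong (applyTranspositions (t ∷ [])) (applyTranspositions-++ ts us y)

odd-length-++ : ∀ {A : Set} (ts us : List A) → odd (length (ts ++ us)) ≡ odd (length ts) xor odd (length us)
odd-length-++ []       us = refl
odd-length-++ (t ∷ ts) us rewrite odd-length-++ ts us with odd (length ts)
... | false = refl
... | true  = not-involutive (odd (length us))

turnTs : Face → (Fin 6 → Bool) → List (Fin 6) → List Transposition
turnTs X h = concatMap (λ s → if h s then quarterTurn X s else [])

turnSlice : Face → (Fin 6 → Bool) → Fin 6 → Fin 24 → Fin 24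
turnSlice X h s z = if h s then turnL X (λ t → does (t ≟ s)) z else z

turnTs-∷ : ∀ X h s ss y → applyTranspositions (turnTs X h (s ∷ ss)) y ≡
  turnSlice X h s (applyTranspositions (turnTs X h ss) y)
turnTs-∷ X h s ss y = trans
  (applyTranspositions-++ (if h s then quarterTurn X s else []) (turnTs X h ss) y)
  (trans (if-float (λ ts → applyTranspositions ts z) (h s)) (cong (if h s then_else z) (quarterTurn-apply X s z)))
  where
  z : Fin 24
  z = applyTranspositions (turnTs X h ss) y

turnSlice-off : ∀ X h s z → axisL X z ≢ s → turnSlice X h s z ≡ z
turnSlice-off X h s z z≢s = trans
  (cong (λ b → if h s then (if b then spinL X z else z) else z) (dec-false (axisL X z ≟ s) z≢s))
  (if-eta (h s))

turnTs-∉ : ∀ X h ss y → All (axisL X y ≢_) ss → applyTranspositions (turnTs X h ss) y ≡ y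
turnTs-∉ X h []       y []         = refl
turnTs-∉ X h (s ∷ ss) y (y≢s ∷ ps) =
  trans (turnTs-∷ X h s ss y)
        (trans (cong (turnSlice X h s) (turnTs-∉ X h ss y ps))
               (turnSlice-off X h s y y≢s))

-- Slices about one axis are disjoint and preserved by the turns, so only the slice containing `y`
-- acts on it; `Unique` ensures that it acts once.
turnTs-∈ : ∀ X h {ss} y → Unique ss → axisL X y ∈ ss →
  applyTranspositions (turnTs X h ss) y ≡ turnL X h y
turnTs-∈ X h {s ∷ ss} y (s∉ss ∷ _) (here refl) =
  trans (turnTs-∷ X h s ss y)
        (trans (cong (turnSlice X h s) (turnTs-∉ X h ss y s∉ss)) lem)
  where
  lem : turnSlice X h s y ≡ turnL X h y
  lem = cong (λ b → if h s then (if b then spinL X y else y) else y) (dec-true (s ≟ s) refl)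
turnTs-∈ X h {s ∷ ss} y (s∉ss ∷ u) (there y∈ss) =
  trans (turnTs-∷ X h s ss y)
        (trans (cong (turnSlice X h s) (turnTs-∈ X h y u y∈ss))
               (turnSlice-off X h s (turnL X h y) (λ e
                   → All.lookup s∉ss y∈ss (sym (trans (sym (axis-turnBy {spin = spinL X} (axisL-spinL X) h y)) e)))))

turnTs-apply : ∀ X h y → applyTranspositions (turnTs X h (allFin 6)) y ≡ turnL X h y
turnTs-apply X h y = turnTs-∈ X h y (allFin⁺ 6) (∈-allFin (axisL X y))

-- Each turned slice contributes three transpositions, hence 1 modulo 2. Mirror slices are paired
-- because the pairs correspond to the coordinates 0, `r` and `c` of an orbit.
turnTs-odd : ∀ X h → odd (length (turnTs X h (allFin 6))) ≡
  (h 0F xor h 5F) xor ((h 1F xor h 4F) xor (h 2F xor h 3F))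
turnTs-odd X h = trans
    (trans (step 0F _) (cong (h 0F xor_) (trans (step 1F _) (cong (h 1F xor_) (trans (step 2F _) (cong (h 2F xor_)
    (trans (step 3F _) (cong (h 3F xor_) (trans (step 4F _) (cong (h 4F xor_) (step 5F [])))))))))))
    (solve 6 (λ x₀ x₁ x₂ x₃ x₄ x₅ →
       x₀ :+ (x₁ :+ (x₂ :+ (x₃ :+ (x₄ :+ (x₅ :+ con false))))) :=
       (x₀ :+ x₅) :+ ((x₁ :+ x₄) :+ (x₂ :+ x₃)))
     refl (h 0F) (h 1F) (h 2F) (h 3F) (h 4F) (h 5F))
  where
  open xor-∧-Solver
  step : ∀ s ts → odd (length ((if h s then quarterTurn X s else []) ++ ts)) ≡ h s xor odd (length ts)
  step s ts = trans (odd-length-++ (if h s then quarterTurn X s else []) ts)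
                    (cong (_xor odd (length ts)) lem)
    where
    if-true : ∀ b → (if b then true else false) ≡ b
    if-true true  = refl
    if-true false = refl
    lem : odd (length (if h s then quarterTurn X s else [])) ≡ h s
    lem = trans (if-float (odd ∘ length) (h s))
      (trans (cong (if h s then_else false) (cong odd (quarterTurn-length X s))) (if-true (h s)))

-- Orbits in the cube of side n

module _ {m : ℕ} where

  private
    n : ℕ
    n = suc m

  opposite-last : opposite (fromℕ m) ≡ fzero
  opposite-last = opposite-involutive fzero

  -- The coordinates 0 to 5 stand for 0, `r`, `c` and their mirror images. Coincidences are allowed:
  -- `r = 0` gives the border edges and corners of the parity argument.
  coords : Fin n → Fin n → CoordMap 5 m
  coords r c = record
    { to          = to
    ; to-zero     = refl
    ; to-opposite = to-opposite
    }
    where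
    to : Fin 6 → Fin n
    to 0F = fzero
    to 1F = r
    to 2F = c
    to 3F = opposite c
    to 4F = opposite r
    to 5F = fromℕ m
    to-opposite : ∀ p → to (opposite p) ≡ opposite (to p)
    to-opposite 0F = refl
    to-opposite 1F = refl
    to-opposite 2F = refl
    to-opposite 3F = sym (opposite-involutive c)
    to-opposite 4F = sym (opposite-involutive r)
    to-opposite 5F = sym opposite-last

  coord : Fin n → Fin n → Fin 6 → Fin n
  coord r c = CoordMap.to (coords r c)

  coord-opposite : ∀ r c s → coord r c (opposite s) ≡ opposite (coord r c s)
  coord-opposite r c = CoordMap.to-opposite (coords r c)

  emb : Fin n → Fin n → Fin 24 → Facelet n
  emb r c y = CoordMap.facelet (coords r c) (label y)

  emb-faceLabel : ∀ f r c → emb r c (faceLabel f) ≡ (f , r , c)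
  emb-faceLabel f r c = cong (CoordMap.facelet (coords r c)) (label-faceLabel f)

  turnOn-emb : ∀ r c X P y → turnOn X P (emb r c y) ≡ emb r c (turnL X (P ∘ coord r c) y)
  turnOn-emb r c X P y = trans (sym (CoordMap.facelet-turnOn (coords r c) X P (label y)))
                               (cong (CoordMap.facelet (coords r c)) (sym (label-turnL X (P ∘ coord r c) y)))

  -- A coincidence of two of the four positions on a face always forces `r` to be its own mirror
  -- image. Restricting `r` alone admits the border, where `r = 0`, and a `c` in the middle.
  emb-injective : ∀ {r} c → r ≢ opposite r → ∀ y z → emb r c y ≡ emb r c z → y ≡ z
  emb-injective {r} c r≢r′ y z e = trans (sym (combine-remQuot {6} 4 y))
    (trans (cong₂ combine face≡ turns≡) (combine-remQuot {6} 4 z))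
    where
    opp-inj : ∀ {p q : Fin n} → opposite p ≡ opposite q → p ≡ q
    opp-inj {p} {q} e = trans (sym (opposite-involutive p)) (trans (cong opposite e) (opposite-involutive q))
    face≡ : proj₁ (remQuot {6} 4 y) ≡ proj₁ (remQuot {6} 4 z)
    face≡ = trans (sym (faceIndex-faceAt _)) (trans (cong faceIndex (,-injectiveˡ e)) (faceIndex-faceAt _))
    distinct : ∀ s t → coord r c (proj₁ (corner s)) ≡ coord r c (proj₁ (corner t)) →
      coord r c (proj₂ (corner s)) ≡ coord r c (proj₂ (corner t)) → s ≡ t
    distinct 0F 0F _ _ = refl
    distinct 0F 1F p q = ⊥-elim (r≢r′ (trans p q))
    distinct 0F 2F p q = ⊥-elim (r≢r′ p)
    distinct 0F 3F p q = ⊥-elim (r≢r′ (trans p (cong opposite q)))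
    distinct 1F 0F p q = ⊥-elim (r≢r′ (sym (trans q p)))
    distinct 1F 1F _ _ = refl
    distinct 1F 2F p q = ⊥-elim (r≢r′ (trans (opp-inj q) p))
    distinct 1F 3F p q = ⊥-elim (r≢r′ (sym q))
    distinct 2F 0F p q = ⊥-elim (r≢r′ (sym p))
    distinct 2F 1F p q = ⊥-elim (r≢r′ (trans (opp-inj (sym q)) (sym p)))
    distinct 2F 2F _ _ = refl
    distinct 2F 3F p q = ⊥-elim (r≢r′ (sym (trans p q)))
    distinct 3F 0F p q = ⊥-elim (r≢r′ (trans (sym p) (cong opposite (sym q))))
    distinct 3F 1F p q = ⊥-elim (r≢r′ q)
    distinct 3F 2F p q = ⊥-elim (r≢r′ (trans q p))
    distinct 3F 3F _ _ = refl
    turns≡ : proj₂ (remQuot {6} 4 y) ≡ proj₂ (remQuot {6} 4 z)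
    turns≡ = distinct _ _ (,-injectiveˡ (,-injectiveʳ e)) (,-injectiveʳ (,-injectiveʳ e))

  wordTs : Fin n → Fin n → List (Move n) → List Transposition
  wordTs r c []      = []
  wordTs r c (M ∷ w) = turnTs (Move.face M) (selects M ∘ coord r c) (allFin 6) ++ wordTs r c w

  applyWord-emb : ∀ r c w y → applyWord w (emb r c y) ≡ emb r c (applyTranspositions (wordTs r c w) y)
  applyWord-emb r c []      y = refl
  applyWord-emb r c (M ∷ w) y = begin
    applyMove M (applyWord w (emb r c y))      ≡⟨ cong (applyMove M) (applyWord-emb r c w y) ⟩
    applyMove M (emb r c z)                    ≡⟨ applyMove-turnOn M _ ⟩
    turnOn X (selects M) (emb r c z)           ≡⟨ turnOn-emb r c X (selects M) z ⟩
    emb r c (turnL X h z)                      ≡⟨ cong (emb r c) (turnTs-apply X h z) ⟨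
    emb r c (applyTranspositions (turnTs X h (allFin 6)) z)
      ≡⟨ cong (emb r c) (applyTranspositions-++ (turnTs X h (allFin 6)) (wordTs r c w) y) ⟨
    emb r c (applyTranspositions (turnTs X h (allFin 6) ++ wordTs r c w) y) ∎
    where
    open ≡-Reasoning
    X : Face
    X = Move.face M
    h : Fin 6 → Bool
    h = selects M ∘ coord r c
    z : Fin 24
    z = applyTranspositions (wordTs r c w) y

  -- The contribution of the coordinate `p` to the parity, whatever the other coordinate of the
  -- orbit; moves about all three axes count alike.
  turnsOdd : List (Move n) → Fin n → Bool
  turnsOdd []      p = false
  turnsOdd (M ∷ w) p = (selects M p xor selects M (opposite p)) xor turnsOdd w p

  wordTs-odd : ∀ r c w → odd (length (wordTs r c w)) ≡ turnsOdd w fzero xor (turnsOdd w r xor turnsOdd w c)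
  wordTs-odd r c []      = refl
  wordTs-odd r c (M ∷ w) = trans
    (odd-length-++ (turnTs (Move.face M) (selects M ∘ coord r c) (allFin 6)) (wordTs r c w))
    (trans (cong₂ _xor_ (turnTs-odd (Move.face M) (selects M ∘ coord r c)) (wordTs-odd r c w))
      (solve 6 (λ u v w x y z →
          (u :+ (v :+ w)) :+ (x :+ (y :+ z)) := (u :+ x) :+ ((v :+ y) :+ (w :+ z))) refl
        (selects M fzero xor selects M (fromℕ m)) (selects M r xor selects M (opposite r))
        (selects M c xor selects M (opposite c))
        (turnsOdd w fzero) (turnsOdd w r) (turnsOdd w c)))
    where open xor-∧-Solver

  -- Fixing the corners forces turnsOdd w 0 to vanish; fixing the wing edges
  -- (0,r) and (0,c) then forces the two other terms to vanish.
  fixes-border⇒even : ∀ {w} r c → fzero ≢ fromℕ m →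
    (∀ p y → applyWord w (emb fzero p y) ≡ emb fzero p y) → odd (length (wordTs r c w)) ≡ false
  fixes-border⇒even {w} r c 0≢last fixes = trans (wordTs-odd r c w)
    (cong₂ _xor_ (turns-even fzero) (cong₂ _xor_ (turns-even r) (turns-even c)))
    where
    turns-even : ∀ p → turnsOdd w p ≡ false
    -- In the orbit `(0 , p)` the term at 0 occurs twice and cancels, so its parity is the term at
    -- `p`; the case `p = 0` is that of the corners.
    turns-even p = trans (solve 2 (λ u v → v := u :+ (u :+ v)) refl (turnsOdd w fzero) (turnsOdd w p))
      (trans (sym (wordTs-odd fzero p w)) (identity-not-odd (wordTs fzero p w) (λ y →
        emb-injective p 0≢last _ y (trans (sym (applyWord-emb fzero p w y)) (fixes p y)))))
      where open xor-∧-Solver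

-- Finite computations with classes of coordinates

∀Bool? : {P : Bool → Set} → (∀ b → Dec (P b)) → Dec (∀ b → P b)
∀Bool? P? = map′ (λ { (p , q) false → p ; (p , q) true → q }) (λ h → h false , h true) (P? false ×-dec P? true)

∀Maybe? : ∀ {n} {P : Maybe (Fin n) → Set} → (∀ u → Dec (P u)) → Dec (∀ u → P u)
∀Maybe? P? = map′ (λ { (p , q) nothing → p ; (p , q) (just u) → q u }) (λ h → h nothing , h ∘ just)
                  (P? nothing ×-dec all? (P? ∘ just))

-- Relative to fixed coordinates α and β, the class of a coordinate p is the s
-- with p = coord α β s, or nothing; these s are unique except that β may be its
-- own mirror image (which the parameter mid tells).
Class : Set
Class = Maybe (Fin 6)

_≈[_]_ : Class → Bool → Fin 6 → Bool
nothing ≈[ mid ] s  = false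
just 2F ≈[ mid ] 3F = mid
just 3F ≈[ mid ] 2F = mid
just u  ≈[ mid ] s  = toℕ u ≡ᵇ toℕ s

oppositeC : Class → Class
oppositeC = mapᵐ opposite

coordC : Class → Class → Fin 6 → Class
coordC u v 0F = just 0F
coordC u v 1F = u
coordC u v 2F = v
coordC u v 3F = oppositeC v
coordC u v 4F = oppositeC u
coordC u v 5F = just 5F

-- X at s turns the slice coord α β s, X off s turns all the other slices.
data Letter : Set where
  _at_ _off_ : Face → Fin 6 → Letter

hits : Bool → Letter → Class → Bool
hits mid (X at s)  u = u ≈[ mid ] s
hits mid (X off s) u = not (u ≈[ mid ] s)

axisFace : Letter → Face
axisFace (X at _)  = X
axisFace (X off _) = X

-- The action of a word on the labels of an orbit whose row and column have the classes `u` and `v`.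
-- The head of the word acts last.
runC : Bool → Class → Class → List Letter → Fin 24 → Fin 24
runC mid u v []      y = y
runC mid u v (l ∷ w) y = turnL (axisFace l) (hits mid l ∘ coordC u v) (runC mid u v w y)

oppositeFace : Face → Face
oppositeFace U = D
oppositeFace D = U
oppositeFace F = B
oppositeFace B = F
oppositeFace R = L
oppositeFace L = R

oppositeFace-involutive : ∀ X → oppositeFace (oppositeFace X) ≡ X
oppositeFace-involutive = from-yes (∀Face? λ X → oppositeFace (oppositeFace X) ≟ᶠ X)

inverseLetter : Letter → Letter
inverseLetter (X at s)  = oppositeFace X at s
inverseLetter (X off s) = oppositeFace X off s

inverseWord : List Letter → List Letter
inverseWord []      = []
inverseWord (l ∷ w) = inverseWord w ++ (inverseLetter l ∷ [])

-- The commutator of the slices L at 2F and B at 1F moves only one facelet of the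
-- layer U, so its commutator with the turn of that layer is a 3-cycle.
threeCycle : List Letter
threeCycle = L at 2F ∷ B at 1F ∷ R at 2F ∷ F at 1F ∷ U at 5F ∷
             B at 1F ∷ L at 2F ∷ F at 1F ∷ R at 2F ∷ D at 5F ∷ []

inOrbitC : Bool → Class → Class → Fin 4 → Bool
inOrbitC mid u v t = (u ≈[ mid ] proj₁ (corner t)) ∧ (v ≈[ mid ] proj₂ (corner t))

-- Two values of `mid`, seven classes each for row and column, and six faces stand for all facelets
-- outside the orbit in every cube.
threeCycle-fixes : ∀ mid u v → ¬ (∃ λ t → inOrbitC mid u v t ≡ true) → ∀ f →
  runC mid u v threeCycle (faceLabel f) ≡ faceLabel f
threeCycle-fixes = from-yes (∀Bool? λ mid → ∀Maybe? λ u → ∀Maybe? λ v →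
  ¬? (any? λ t → inOrbitC mid u v t ≟ᵇ true) →-dec ∀Face? λ f →
  runC mid u v threeCycle (faceLabel f) ≟ faceLabel f)

-- A middle slice is not turned by any move, but turning all other slices has,
-- up to a rotation of the whole cube, the same conjugates.
conjugate-middle : ∀ u v f →
  runC true u v (L at 2F ∷ B at 1F ∷ R at 2F ∷ []) (faceLabel f) ≡
  runC true u v (R off 2F ∷ U at 4F ∷ L off 2F ∷ []) (faceLabel f)
conjugate-middle = from-yes (∀Maybe? λ u → ∀Maybe? λ v → ∀Face? λ f →
  runC true u v (L at 2F ∷ B at 1F ∷ R at 2F ∷ []) (faceLabel f) ≟
  runC true u v (R off 2F ∷ U at 4F ∷ L off 2F ∷ []) (faceLabel f))

conjugate-middle⁻¹ : ∀ u v f →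
  runC true u v (L at 2F ∷ F at 1F ∷ R at 2F ∷ []) (faceLabel f) ≡
  runC true u v (R off 2F ∷ D at 4F ∷ L off 2F ∷ []) (faceLabel f)
conjugate-middle⁻¹ = from-yes (∀Maybe? λ u → ∀Maybe? λ v → ∀Face? λ f →
  runC true u v (L at 2F ∷ F at 1F ∷ R at 2F ∷ []) (faceLabel f) ≟
  runC true u v (R off 2F ∷ D at 4F ∷ L off 2F ∷ []) (faceLabel f))

-- The 3-cycle 0 → 8 → x → 0, and the identity for `x = 8`. The labels 0 and 8 are two of the three
-- that `threeCycle` moves.
cycle₀₈ : Fin 24 → Fin 24 → Fin 24
cycle₀₈ x y = transpose 0F x ⟨$⟩ʳ (transpose 0F 8F ⟨$⟩ʳ y)

-- Words, found by breadth-first search, moving the 3-cycle 0 → 8 → 1 → 0 of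
-- threeCycle to 0 → 8 → x → 0 (the entries for x = 0 and x = 8 are not used).
conjugators : Vec (List Letter) 24
conjugators =
  [] ∷
  [] ∷
  (B at 1F ∷ U at 5F ∷ F at 1F ∷ []) ∷
  (B at 1F ∷ U at 5F ∷ U at 5F ∷ F at 1F ∷ []) ∷
  (U at 0F ∷ R at 4F ∷ R at 4F ∷ []) ∷
  (R at 4F ∷ R at 4F ∷ []) ∷
  (D at 0F ∷ R at 4F ∷ R at 4F ∷ []) ∷
  (R at 1F ∷ F at 0F ∷ F at 0F ∷ R at 4F ∷ []) ∷
  [] ∷
  (L at 4F ∷ []) ∷
  (F at 5F ∷ L at 4F ∷ B at 5F ∷ []) ∷
  (U at 5F ∷ U at 5F ∷ L at 1F ∷ U at 5F ∷ U at 5F ∷ []) ∷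
  (B at 0F ∷ R at 4F ∷ []) ∷
  (F at 0F ∷ F at 0F ∷ R at 4F ∷ []) ∷
  (F at 0F ∷ R at 4F ∷ []) ∷
  (R at 4F ∷ []) ∷
  (R at 5F ∷ D at 5F ∷ F at 4F ∷ U at 5F ∷ []) ∷
  (U at 5F ∷ F at 1F ∷ D at 5F ∷ []) ∷
  (U at 1F ∷ F at 0F ∷ R at 4F ∷ []) ∷
  (D at 5F ∷ F at 4F ∷ U at 5F ∷ []) ∷
  (R at 0F ∷ D at 5F ∷ B at 4F ∷ U at 5F ∷ []) ∷
  (D at 5F ∷ B at 4F ∷ U at 5F ∷ []) ∷
  (D at 1F ∷ F at 0F ∷ R at 4F ∷ []) ∷
  (U at 5F ∷ B at 1F ∷ D at 5F ∷ []) ∷ []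

conjugated : Fin 24 → List Letter
conjugated x = lookup conjugators x ++ threeCycle ++ inverseWord (lookup conjugators x)

conjugated-cycle : ∀ mid x → x ≢ 0F → x ≢ 8F → ∀ y →
  runC mid (just 1F) (just 2F) (conjugated x) y ≡ cycle₀₈ x y
conjugated-cycle = from-yes (∀Bool? λ mid → all? λ x → ¬? (x ≟ 0F) →-dec ¬? (x ≟ 8F) →-dec all? λ y →
  runC mid (just 1F) (just 2F) (conjugated x) y ≟ cycle₀₈ x y)

-- The square of a 3-cycle is its inverse, which exchanges the two transpositions. It replaces an
-- inverse when (0 x)(0 y) is assembled.
cycle₀₈-square : ∀ x → x ≢ 0F → ∀ y →
  cycle₀₈ x (cycle₀₈ x y) ≡ transpose 0F 8F ⟨$⟩ʳ (transpose 0F x ⟨$⟩ʳ y)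
cycle₀₈-square = from-yes (all? λ x → ¬? (x ≟ 0F) →-dec all? λ y →
  cycle₀₈ x (cycle₀₈ x y) ≟ (transpose 0F 8F ⟨$⟩ʳ (transpose 0F x ⟨$⟩ʳ y)))

spinL-oppositeFace : ∀ X y → spinL (oppositeFace X) (spinL X y) ≡ y
spinL-oppositeFace = from-yes (∀Face? λ X → all? λ y → spinL (oppositeFace X) (spinL X y) ≟ y)

spinL-cube : ∀ X y → spinL X (spinL X (spinL X y)) ≡ spinL (oppositeFace X) y
spinL-cube = from-yes (∀Face? λ X → all? λ y → spinL X (spinL X (spinL X y)) ≟ spinL (oppositeFace X) y)

axisL-oppositeFace : ∀ X y → axisL (oppositeFace X) y ≡ axisL X y
axisL-oppositeFace = from-yes (∀Face? λ X → all? λ y → axisL (oppositeFace X) y ≟ axisL X y)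

_==_ : ∀ {n} → Fin n → Fin n → Bool
p == q = toℕ p ≡ᵇ toℕ q

≡⇒== : ∀ {n} {p q : Fin n} → p ≡ q → (p == q) ≡ true
≡⇒== {p = p} refl = Equivalence.to T-≡ (≡⇒≡ᵇ (toℕ p) (toℕ p) refl)

==⇒≡ : ∀ {n} {p q : Fin n} → (p == q) ≡ true → p ≡ q
==⇒≡ {p = p} {q} e = toℕ-injective (≡ᵇ⇒≡ (toℕ p) (toℕ q) (Equivalence.from T-≡ e))

≢⇒== : ∀ {n} {p q : Fin n} → p ≢ q → (p == q) ≡ false
≢⇒== p≢q = ¬-not (p≢q ∘ ==⇒≡)

==-sym : ∀ {n} (p q : Fin n) → (p == q) ≡ (q == p)
==-sym p q with p ≟ q
... | yes refl = refl
... | no p≢q = trans (≢⇒== p≢q) (sym (≢⇒== (p≢q ∘ sym)))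

opposite-swap : ∀ {n} {p q : Fin n} → opposite p ≡ q → p ≡ opposite q
opposite-swap {p = p} e = trans (sym (opposite-involutive p)) (cong opposite e)

-- The cube group

InG-id : ∀ {n} → InG n id
InG-id = [] , λ _ → refl

applyWord-++ : ∀ {n} (v w : List (Move n)) x → applyWord (v ++ w) x ≡ applyWord v (applyWord w x)
applyWord-++ []      w x = refl
applyWord-++ (M ∷ v) w x = cong (applyMove M) (applyWord-++ v w x)

InG-∘ : ∀ {n g h} → InG n g → InG n h → InG n (g ∘ h)
InG-∘ {g = g} (v , g≗v) (w , h≗w) = v ++ w , λ x →
  trans (cong g (h≗w x)) (trans (g≗v (applyWord w x)) (sym (applyWord-++ v w x)))

InG-≗ : ∀ {n g h} → (∀ x → g x ≡ h x) → InG n h → InG n g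
InG-≗ g≗h (w , h≗w) = w , λ x → trans (g≗h x) (h≗w x)

module _ {m : ℕ} where

  private
    n : ℕ
    n = suc m

  -- Every facelet (f , r , c) is the facelet labelled (f , 1 , 2) of its own orbit.
  by-labels : {A : Set} {g h : Facelet n → A} → (∀ r c y → g (emb r c y) ≡ h (emb r c y)) → ∀ x → g x ≡ h x
  by-labels {g = g} {h} e (f , r , c) = subst (λ x → g x ≡ h x) (emb-faceLabel f r c) (e r c (faceLabel f))

  axis-emb : ∀ (r c : Fin n) X y → axis X (emb r c y) ≡ coord r c (axisL X y)
  axis-emb r c X y = sym (CoordMap.to-axis (coords r c) X (label y))

  spin-emb : ∀ (r c : Fin n) X y → spin X (emb r c y) ≡ emb r c (spinL X y)
  spin-emb r c X y = trans (sym (CoordMap.facelet-spin (coords r c) X (label y)))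
                           (cong (CoordMap.facelet (coords r c)) (sym (label-spinL X y)))

  axis-spin : ∀ X (x : Facelet n) → axis X (spin X x) ≡ axis X x
  axis-spin X = by-labels λ r c y → trans (cong (axis X) (spin-emb r c X y))
    (trans (axis-emb r c X (spinL X y)) (trans (cong (coord r c) (axisL-spinL X y)) (sym (axis-emb r c X y))))

  axis-oppositeFace : ∀ X (x : Facelet n) → axis (oppositeFace X) x ≡ axis X x
  axis-oppositeFace X = by-labels λ r c y → trans (axis-emb r c (oppositeFace X) y)
    (trans (cong (coord r c) (axisL-oppositeFace X y)) (sym (axis-emb r c X y)))

  spin-oppositeFace : ∀ X (x : Facelet n) → spin (oppositeFace X) (spin X x) ≡ x
  spin-oppositeFace X = by-labels λ r c y → trans (cong (spin (oppositeFace X)) (spin-emb r c X y))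
    (trans (spin-emb r c (oppositeFace X) (spinL X y)) (cong (emb r c) (spinL-oppositeFace X y)))

  spin-cube : ∀ X (x : Facelet n) → spin X (spin X (spin X x)) ≡ spin (oppositeFace X) x
  spin-cube X = by-labels λ r c y → trans (cong (spin X ∘ spin X) (spin-emb r c X y))
    (trans (cong (spin X) (spin-emb r c X (spinL X y))) (trans (spin-emb r c X (spinL X (spinL X y)))
    (trans (cong (emb r c) (spinL-cube X y)) (sym (spin-emb r c (oppositeFace X) y)))))

  -- Seen from the opposite face the turn is the inverse one, and the inverse of a quarter turn is
  -- its third power.
  InG-oppositeFace : ∀ X P → InG n (turnOn X P) → InG n (turnOn (oppositeFace X) P)
  InG-oppositeFace X P g = InG-≗ (λ x → sym (turnBy-cube {axis = axis X} {spin X} (axis-spin X) (axis-oppositeFace X) (spin-cube X) P x)) (InG-∘ g (InG-∘ g g))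

  InG-move : ∀ (M : Move n) {P} → (∀ p → P p ≡ selects M p) → InG n (turnOn (Move.face M) P)
  InG-move M P≗M = (M ∷ []) , λ x → trans (turnOn-cong (Move.face M) P≗M x) (sym (applyMove-turnOn M x))

  toℕ-opposite : ∀ (s : Fin n) → toℕ s + suc (toℕ (opposite s)) ≡ n
  toℕ-opposite s = trans (cong (λ k → toℕ s + suc k) (opposite-prop s))
    (trans (+-suc (toℕ s) (m ∸ toℕ s)) (cong suc (m+[n∸m]≡n (toℕ≤pred[n] s))))

  below-half : ∀ (s : Fin n) → toℕ s < toℕ (opposite s) → toℕ s < ⌊ n /2⌋
  below-half s s<s′ = subst (_≤ ⌊ n /2⌋) (sym (n≡⌊n+n/2⌋ (suc (toℕ s)))) (⌊n/2⌋-mono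
    (≤-trans (≤-reflexive (sym (+-suc (toℕ s) (suc (toℕ s)))))
    (≤-trans (+-monoʳ-≤ (toℕ s) (s≤s s<s′)) (≤-reflexive (toℕ-opposite s)))))

  -- A move reaches a slice only from the nearer face; from the farther face the slice turns by the
  -- inverse. Either half of the cube thus leaves three faces to `InG-oppositeFace`.
  InG-turn : ∀ X {s : Fin n} → s ≢ opposite s → InG n (turnOn X (_== s))
  InG-turn X {s} s≢s′ with <-cmp (toℕ s) (toℕ (opposite s))
  ... | tri≈ _ s≡s′ _ = ⊥-elim (s≢s′ (toℕ-injective s≡s′))
  ... | tri< s<s′ _ _ = low X
    where
    from : ∀ X → layer {n} X (suc (toℕ s)) ≡ toℕ s → InG n (turnOn X (_== s))
    from X e = InG-move (mv X (suc (toℕ s)) (s≤s z≤n) (below-half s s<s′)) (λ p → cong (toℕ p ≡ᵇ_) (sym e))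
    low : ∀ X → InG n (turnOn X (_== s))
    low B = from B refl
    low L = from L refl
    low D = from D refl
    low F = InG-oppositeFace B (_== s) (from B refl)
    low R = InG-oppositeFace L (_== s) (from L refl)
    low U = InG-oppositeFace D (_== s) (from D refl)
  ... | tri> _ _ s′<s = high X
    where
    s′ : Fin n
    s′ = opposite s
    layer≡ : n ∸ suc (toℕ s′) ≡ toℕ s
    layer≡ = trans (sym (opposite-prop s′)) (cong toℕ (opposite-involutive s))
    from : ∀ X → layer {n} X (suc (toℕ s′)) ≡ toℕ s → InG n (turnOn X (_== s))
    from X e = InG-move (mv X (suc (toℕ s′)) (s≤s z≤n)
      (below-half s′ (subst (toℕ s′ <_) (cong toℕ (sym (opposite-involutive s))) s′<s)))
      (λ p → cong (toℕ p ≡ᵇ_) (sym e))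
    high : ∀ X → InG n (turnOn X (_== s))
    high F = from F layer≡
    high R = from R layer≡
    high U = from U layer≡
    high B = InG-oppositeFace F (_== s) (from F layer≡)
    high L = InG-oppositeFace R (_== s) (from R layer≡)
    high D = InG-oppositeFace U (_== s) (from U layer≡)

  -- The slices are added one at a time in the order of their coordinates; disjoint slices about one
  -- axis compose to the turn of their union. This supplies the turn of all slices but the middle.
  InG-turnOn : ∀ X P → (∀ {s : Fin n} → P s ≡ true → s ≢ opposite s) → InG n (turnOn X P)
  InG-turnOn X P P⇒≢ = InG-≗ (turnOn-cong X λ p → sym
      (trans (cong (P p ∧_) (Equivalence.to T-≡ (<⇒<ᵇ (toℕ<n p)))) (∧-identityʳ (P p)))) (below n ≤-refl)
    where
    below : ∀ k → k ≤ n → InG n (turnOn X (λ p → P p ∧ (toℕ p <ᵇ k)))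
    below zero k≤n = InG-≗ (turnOn-cong X λ p → ∧-zeroʳ (P p)) InG-id
    below (suc k) k<n = step (P s) refl
      where
      s : Fin n
      s = fromℕ< k<n
      <ᵇ-suc : ∀ i k → (i <ᵇ suc k) ≡ (i <ᵇ k) ∨ (i ≡ᵇ k)
      <ᵇ-suc zero    zero    = refl
      <ᵇ-suc zero    (suc k) = refl
      <ᵇ-suc (suc i) zero    = refl
      <ᵇ-suc (suc i) (suc k) = <ᵇ-suc i k
      split : ∀ p → (P p ∧ (toℕ p <ᵇ suc k)) ≡ (P p ∧ (toℕ p <ᵇ k)) ∨ (P p ∧ (p == s))
      split p rewrite toℕ-fromℕ< k<n | <ᵇ-suc (toℕ p) k with P p
      ... | true  = refl
      ... | false = refl
      step : ∀ b → P s ≡ b → InG n (turnOn X (λ p → P p ∧ (toℕ p <ᵇ suc k)))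
      step false Ps = InG-≗ (turnOn-cong X λ p → trans (split p) (lem p))
                           (below k (≤-trans (n≤1+n k) k<n))
        where
        lem : ∀ p → (P p ∧ (toℕ p <ᵇ k)) ∨ (P p ∧ (p == s)) ≡ P p ∧ (toℕ p <ᵇ k)
        lem p with p ≟ s
        ... | yes refl rewrite Ps = refl
        ... | no p≢s rewrite ≢⇒== p≢s | ∧-zeroʳ (P p) = ∨-identityʳ _
      step true Ps = InG-≗ (λ x → trans (turnOn-cong X (λ p → trans (split p) (lem p)) x)
                                        (sym (turnBy-disjoint {axis = axis X} {spin X} (axis-spin X) disj x)))
                           (InG-∘ (below k (≤-trans (n≤1+n k) k<n)) (InG-turn X (P⇒≢ Ps)))
        where
        lem : ∀ p → (P p ∧ (toℕ p <ᵇ k)) ∨ (P p ∧ (p == s)) ≡ (P p ∧ (toℕ p <ᵇ k)) ∨ (p == s)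
        lem p with p ≟ s
        ... | yes refl rewrite Ps = refl
        ... | no p≢s rewrite ≢⇒== p≢s | ∧-zeroʳ (P p) = refl
        disj : ∀ p → (p == s) ≡ true → P p ∧ (toℕ p <ᵇ k) ≡ false
        disj p e rewrite trans (cong toℕ (==⇒≡ {p = p} e)) (toℕ-fromℕ< k<n) | <ᵇ-irrefl k = ∧-zeroʳ (P p)

  middle-unique : ∀ {p q : Fin n} → p ≡ opposite p → q ≡ opposite q → p ≡ q
  middle-unique {p} {q} p≡p′ q≡q′ = toℕ-injective (trans (n≡⌊n+n/2⌋ (toℕ p))
    (trans (cong ⌊_/2⌋ (suc-injective (trans (double p p≡p′) (sym (double q q≡q′))))) (sym (n≡⌊n+n/2⌋ (toℕ q)))))
    where
    double : ∀ (p : Fin n) → p ≡ opposite p → suc (toℕ p + toℕ p) ≡ n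
    double p e = trans (sym (+-suc (toℕ p) (toℕ p))) (trans (cong (λ q → toℕ p + suc (toℕ q)) e) (toℕ-opposite p))

-- Products of transpositions that move 0

applyStars : List (Fin 24) → Fin 24 → Fin 24
applyStars []       y = y
applyStars (x ∷ xs) y = transpose 0F x ⟨$⟩ʳ applyStars xs y

applyStars-++ : ∀ xs ys z → applyStars (xs ++ ys) z ≡ applyStars xs (applyStars ys z)
applyStars-++ []       ys z = refl
applyStars-++ (x ∷ xs) ys z = cong (transpose 0F x ⟨$⟩ʳ_) (applyStars-++ xs ys z)

transpose-comm : ∀ {n} (x y : Fin n) z → transpose x y ⟨$⟩ʳ z ≡ transpose y x ⟨$⟩ʳ z
transpose-comm x y z with z ≟ x
... | yes refl = sym (transpose-snd y z)
... | no z≢x with z ≟ y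
...   | yes refl = refl
...   | no z≢y rewrite dec-false (z ≟ x) z≢x = refl

transpose-involutive : ∀ {n} (x y : Fin n) z → transpose x y ⟨$⟩ʳ (transpose x y ⟨$⟩ʳ z) ≡ z
transpose-involutive x y z = trans (transpose-comm x y (transpose x y ⟨$⟩ʳ z)) (inverseˡ (transpose x y))

-- Conjugating (0 y) by (0 x) gives (x y). One or three factors are used, so replacing a
-- transposition keeps the parity.
stars : ∀ {x y : Fin 24} → x ≢ y → ∃ λ zs →
  All (_≢ 0F) zs × odd (length zs) ≡ true × (∀ z → transpose x y ⟨$⟩ʳ z ≡ applyStars zs z)
stars {x} {y} x≢y with x ≟ 0F | y ≟ 0F
... | yes refl | yes refl = ⊥-elim (x≢y refl)
... | yes refl | no y≢0 = y ∷ [] , y≢0 ∷ [] , refl , λ _ → refl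
... | no x≢0 | yes refl = x ∷ [] , x≢0 ∷ [] , refl , transpose-comm x 0F
... | no x≢0 | no y≢0 = x ∷ y ∷ x ∷ [] , x≢0 ∷ y≢0 ∷ x≢0 ∷ [] , refl , λ z → begin
  transpose x y ⟨$⟩ʳ z
    ≡⟨ cong₂ (λ u v → transpose u v ⟨$⟩ʳ z) (transpose-fst 0F x) (transpose-other y≢0 (x≢y ∘ sym)) ⟨
  transpose (τ ⟨$⟩ʳ 0F) (τ ⟨$⟩ʳ y) ⟨$⟩ʳ z
    ≡⟨ cong (transpose (τ ⟨$⟩ʳ 0F) (τ ⟨$⟩ʳ y) ⟨$⟩ʳ_) (transpose-involutive 0F x z) ⟨
  transpose (τ ⟨$⟩ʳ 0F) (τ ⟨$⟩ʳ y) ⟨$⟩ʳ (τ ⟨$⟩ʳ (τ ⟨$⟩ʳ z))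
    ≡⟨ transpose-conj τ 0F y (τ ⟨$⟩ʳ z) ⟩
  τ ⟨$⟩ʳ (transpose 0F y ⟨$⟩ʳ (τ ⟨$⟩ʳ z)) ∎
  where
  open ≡-Reasoning
  τ : Permutation′ 24
  τ = transpose 0F x

toStars : ∀ ts → ∃ λ zs →
  All (_≢ 0F) zs × odd (length zs) ≡ odd (length ts) × (∀ z → applyTranspositions ts z ≡ applyStars zs z)
toStars [] = [] , [] , refl , λ _ → refl
toStars (((x , y) , x≢y) ∷ ts) with stars x≢y | toStars ts
... | zs , zs≢0 , zs-odd , zs≗ | ws , ws≢0 , ws-odd , ws≗ =
  zs ++ ws , ++⁺ zs≢0 ws≢0 ,
  trans (odd-length-++ zs ws) (cong₂ _xor_ zs-odd ws-odd) ,
  λ z → trans (cong (transpose x y ⟨$⟩ʳ_) (ws≗ z)) (trans (zs≗ (applyStars ws z)) (sym (applyStars-++ zs ws z)))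

odd-double : ∀ k → odd (2 * k) ≡ false
odd-double zero = refl
odd-double (suc k) = trans (cong odd (*-suc 2 k)) (trans (not-involutive _) (odd-double k))

even⇒double : ∀ n → odd n ≡ false → ∃ λ k → n ≡ 2 * k
even⇒double zero e = 0 , refl
even⇒double (suc zero) ()
even⇒double (suc (suc n)) e with even⇒double n (trans (sym (not-involutive _)) e)
... | k , refl = suc k , sym (*-suc 2 k)

-- Words in a cube of any side

-- With their mirror images, the eight inequalities separate all pairs of the six coordinates except
-- `β` and `opposite β`, which coincide when `β` is the middle of an odd side.
record Generic {m} (α β : Fin (suc m)) : Set where
  field
    0≢last : fzero ≢ fromℕ m
    0≢α    : fzero ≢ α
    0≢β    : fzero ≢ β
    0≢α′   : fzero ≢ opposite α
    0≢β′   : fzero ≢ opposite β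
    α≢α′   : α ≢ opposite α
    α≢β    : α ≢ β
    α≢β′   : α ≢ opposite β

-- Slices other than the two that may be the middle slice.
Safe : Letter → Set
Safe (X at s)  = s ≢ 2F × s ≢ 3F
Safe (X off s) = ⊥

safe? : ∀ l → Dec (Safe l)
safe? (X at s)  = ¬? (s ≟ 2F) ×-dec ¬? (s ≟ 3F)
safe? (X off s) = no id

conjugators-safe : ∀ x → All Safe (lookup conjugators x)
conjugators-safe = from-yes (all? λ x → All.all? safe? (lookup conjugators x))

module _ {m : ℕ} {α β : Fin (suc m)} (generic : Generic α β) where

  open Generic generic

  private
    n : ℕ
    n = suc m

    mid : Bool
    mid = β == opposite β

    sp : Fin 6 → Fin n
    sp = coord α β

    mirror : ∀ {p q : Fin n} → p ≢ q → opposite p ≢ opposite q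
    mirror p≢q e = p≢q (trans (opposite-swap e) (opposite-involutive _))

    mirrorʳ : ∀ {p q : Fin n} → p ≢ opposite q → opposite p ≢ q
    mirrorʳ p≢q′ e = p≢q′ (opposite-swap e)

    flip-≢ : ∀ {p q : Fin n} → p ≢ q → q ≢ p
    flip-≢ p≢q = p≢q ∘ sym

    ≢0⇒≢last : ∀ {p : Fin n} → fzero ≢ opposite p → p ≢ fromℕ m
    ≢0⇒≢last 0≢p′ refl = 0≢p′ (sym opposite-last)

    same : ∀ (p : Fin n) → (p == p) ≡ true
    same p = ≡⇒== {p = p} refl

    differ : ∀ s t → sp s ≢ sp t → (sp s == sp t) ≡ false
    differ s t = ≢⇒==

    differ′ : ∀ s t → sp t ≢ sp s → (sp s == sp t) ≡ false
    differ′ s t ne = ≢⇒== (flip-≢ ne)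

    α≢last : α ≢ fromℕ m
    α≢last = ≢0⇒≢last 0≢α′
    β≢last : β ≢ fromℕ m
    β≢last = ≢0⇒≢last 0≢β′
    β′≢last : opposite β ≢ fromℕ m
    β′≢last = mirror (flip-≢ 0≢β)
    α′≢last : opposite α ≢ fromℕ m
    α′≢last = mirror (flip-≢ 0≢α)
    β≢α′ : β ≢ opposite α
    β≢α′ = flip-≢ (mirrorʳ α≢β′)
    β′≢α′ : opposite β ≢ opposite α
    β′≢α′ = mirror (flip-≢ α≢β)

  coord-== : ∀ s t → (sp s == sp t) ≡ just s ≈[ mid ] t
  coord-== 0F 0F = same (sp 0F)
  coord-== 0F 1F = differ 0F 1F 0≢α
  coord-== 0F 2F = differ 0F 2F 0≢β
  coord-== 0F 3F = differ 0F 3F 0≢β′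
  coord-== 0F 4F = differ 0F 4F 0≢α′
  coord-== 0F 5F = differ 0F 5F 0≢last
  coord-== 1F 0F = differ′ 1F 0F 0≢α
  coord-== 1F 1F = same (sp 1F)
  coord-== 1F 2F = differ 1F 2F α≢β
  coord-== 1F 3F = differ 1F 3F α≢β′
  coord-== 1F 4F = differ 1F 4F α≢α′
  coord-== 1F 5F = differ 1F 5F α≢last
  coord-== 2F 0F = differ′ 2F 0F 0≢β
  coord-== 2F 1F = differ′ 2F 1F α≢β
  coord-== 2F 2F = same (sp 2F)
  coord-== 2F 3F = refl
  coord-== 2F 4F = differ 2F 4F β≢α′
  coord-== 2F 5F = differ 2F 5F β≢last
  coord-== 3F 0F = differ′ 3F 0F 0≢β′
  coord-== 3F 1F = differ′ 3F 1F α≢β′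
  coord-== 3F 2F = ==-sym (opposite β) β
  coord-== 3F 3F = same (sp 3F)
  coord-== 3F 4F = differ 3F 4F β′≢α′
  coord-== 3F 5F = differ 3F 5F β′≢last
  coord-== 4F 0F = differ′ 4F 0F 0≢α′
  coord-== 4F 1F = differ′ 4F 1F α≢α′
  coord-== 4F 2F = differ′ 4F 2F β≢α′
  coord-== 4F 3F = differ′ 4F 3F β′≢α′
  coord-== 4F 4F = same (sp 4F)
  coord-== 4F 5F = differ 4F 5F α′≢last
  coord-== 5F 0F = differ′ 5F 0F 0≢last
  coord-== 5F 1F = differ′ 5F 1F α≢last
  coord-== 5F 2F = differ′ 5F 2F β≢last
  coord-== 5F 3F = differ′ 5F 3F β′≢last
  coord-== 5F 4F = differ′ 5F 4F α′≢last
  coord-== 5F 5F = same (sp 5F)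

  record HasClass (p : Fin n) (u : Class) : Set where
    constructor hasClass
    field
      direct   : ∀ s → (p == sp s) ≡ u ≈[ mid ] s
      mirrored : ∀ s → (opposite p == sp s) ≡ oppositeC u ≈[ mid ] s

  open HasClass

  coord-class : ∀ t → HasClass (sp t) (just t)
  coord-class t = hasClass (coord-== t) λ s →
    trans (cong (_== sp s) (sym (coord-opposite α β t))) (coord-== (opposite t) s)

  classify : ∀ p → ∃ (HasClass p)
  classify p with any? (λ s → p ≟ sp s)
  ... | yes (s , refl) = just s , coord-class s
  ... | no ∄s = nothing , hasClass (λ s → ≢⇒== (λ e → ∄s (s , e)))
    λ s → ≢⇒== (λ e → ∄s (opposite s , trans (opposite-swap e) (sym (coord-opposite α β s))))

  letterSlices : Letter → Fin n → Bool
  letterSlices (X at s)  p = p == sp s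
  letterSlices (X off s) p = not (p == sp s)

  run : List Letter → Facelet n → Facelet n
  run []      x = x
  run (l ∷ w) x = turnOn (axisFace l) (letterSlices l) (run w x)

  run-++ : ∀ v w x → run (v ++ w) x ≡ run v (run w x)
  run-++ []      w x = refl
  run-++ (l ∷ v) w x = cong (turnOn (axisFace l) (letterSlices l)) (run-++ v w x)

  -- This carries the finite checks over to every cube: whether a letter turns a slice met by the
  -- orbit of `p` and `q` can be read from the classes of `p` and `q`.
  run-emb : ∀ {p q u v} → HasClass p u → HasClass q v → ∀ w y →
    run w (emb p q y) ≡ emb p q (runC mid u v w y)
  run-emb P Q [] y = refl
  run-emb {p} {q} {u} {v} P Q (l ∷ w) y = begin
    turnOn X (letterSlices l) (run w (emb p q y))   ≡⟨ cong (turnOn X (letterSlices l)) (run-emb P Q w y) ⟩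
    turnOn X (letterSlices l) (emb p q z)           ≡⟨ turnOn-emb p q X (letterSlices l) z ⟩
    emb p q (turnL X (letterSlices l ∘ coord p q) z)
      ≡⟨ cong (emb p q) (turnBy-cong {axis = axisL X} {spinL X} (λ s → slices≡ l s) z) ⟩
    emb p q (turnL X (hits mid l ∘ coordC u v) z)   ∎
    where
    open ≡-Reasoning
    X : Face
    X = axisFace l
    z : Fin 24
    z = runC mid u v w y
    coords≡ : ∀ t s → (coord p q t == sp s) ≡ coordC u v t ≈[ mid ] s
    coords≡ 0F = coord-== 0F
    coords≡ 1F = direct P
    coords≡ 2F = direct Q
    coords≡ 3F = mirrored Q
    coords≡ 4F = mirrored P
    coords≡ 5F = coord-== 5F
    slices≡ : ∀ l t → letterSlices l (coord p q t) ≡ hits mid l (coordC u v t)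
    slices≡ (X at s)  t = coords≡ t s
    slices≡ (X off s) t = cong not (coords≡ t s)

  run-orbit : ∀ w y → run w (emb α β y) ≡ emb α β (runC mid (just 1F) (just 2F) w y)
  run-orbit = run-emb (coord-class 1F) (coord-class 2F)

  run-by-classes : ∀ v w →
    (∀ p q f → runC mid p q v (faceLabel f) ≡ runC mid p q w (faceLabel f)) →
    ∀ x → run v x ≡ run w x
  run-by-classes v w e (f , p , q) = subst (λ x → run v x ≡ run w x) (emb-faceLabel f p q)
    (trans (run-emb P Q v (faceLabel f)) (trans (cong (emb p q) (e _ _ f)) (sym (run-emb P Q w (faceLabel f)))))
    where
    P : HasClass p (proj₁ (classify p))
    P = proj₂ (classify p)
    Q : HasClass q (proj₁ (classify q))
    Q = proj₂ (classify q)

  cancel-turn : ∀ X P (x : Facelet n) → turnOn X P (turnOn (oppositeFace X) P x) ≡ x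
  cancel-turn X P x = subst (λ Y → turnOn Y P (turnOn (oppositeFace X) P x) ≡ x) (oppositeFace-involutive X)
    (turnBy-inverse {axis = axis (oppositeFace X)} {spin (oppositeFace X)} (axis-spin (oppositeFace X))
      {spin′ = spin (oppositeFace (oppositeFace X))}
      (axis-oppositeFace (oppositeFace X)) (spin-oppositeFace (oppositeFace X)) P x)

  run-inverseLetter : ∀ l x → run (l ∷ []) (run (inverseLetter l ∷ []) x) ≡ x
  run-inverseLetter (X at s)  x = cancel-turn X (_== sp s) x
  run-inverseLetter (X off s) x = cancel-turn X (λ p → not (p == sp s)) x

  run-inverse : ∀ w x → run w (run (inverseWord w) x) ≡ x
  run-inverse []      x = refl
  run-inverse (l ∷ w) x = trans (cong (run (l ∷ w)) (run-++ (inverseWord w) (inverseLetter l ∷ []) x))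
    (trans (cong (run (l ∷ [])) (run-inverse w (run (inverseLetter l ∷ []) x))) (run-inverseLetter l x))

  Orbit : Facelet n → Set
  Orbit x = ∃ λ y → emb α β y ≡ x

  orbit-corner : ∀ f t → Orbit (f , sp (proj₁ (corner t)) , sp (proj₂ (corner t)))
  orbit-corner f t = combine (faceIndex f) t , subst (λ (k , t′) → at-corner (faceAt k) t′ ≡ at-corner f t)
    (sym (remQuot-combine {6} {4} (faceIndex f) t)) (cong (λ g → at-corner g t) (faceAt-faceIndex f))
    where
    at-corner : Face → Fin 4 → Facelet n
    at-corner f t = f , sp (proj₁ (corner t)) , sp (proj₂ (corner t))

  run-outside : ∀ w →
    (∀ u v → ¬ (∃ λ t → inOrbitC mid u v t ≡ true) → ∀ f → runC mid u v w (faceLabel f) ≡ faceLabel f) →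
    ∀ x → ¬ Orbit x → run w x ≡ x
  run-outside w w-fixes (f , p , q) x∉ = subst (λ x → run w x ≡ x) (emb-faceLabel f p q)
    (trans (run-emb P Q w (faceLabel f)) (cong (emb p q) (w-fixes u v outside f)))
    where
    u v : Class
    u = proj₁ (classify p)
    v = proj₁ (classify q)
    P : HasClass p u
    P = proj₂ (classify p)
    Q : HasClass q v
    Q = proj₂ (classify q)
    ∧-true : ∀ b {c} → b ∧ c ≡ true → b ≡ true × c ≡ true
    ∧-true true e = refl , e
    outside : ¬ (∃ λ t → inOrbitC mid u v t ≡ true)
    outside (t , e) = x∉ (subst Orbit (cong (f ,_) (cong₂ _,_ (sym p≡) (sym q≡))) (orbit-corner f t))
      where
      both : (u ≈[ mid ] proj₁ (corner t)) ≡ true × (v ≈[ mid ] proj₂ (corner t)) ≡ true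
      both = ∧-true (u ≈[ mid ] proj₁ (corner t)) e
      p≡ : p ≡ sp (proj₁ (corner t))
      p≡ = ==⇒≡ {p = p} {sp (proj₁ (corner t))} (trans (direct P (proj₁ (corner t))) (proj₁ both))
      q≡ : q ≡ sp (proj₂ (corner t))
      q≡ = ==⇒≡ {p = q} {sp (proj₂ (corner t))} (trans (direct Q (proj₂ (corner t))) (proj₂ both))

  InG-safe : ∀ l → Safe l → InG n (turnOn (axisFace l) (letterSlices l))
  InG-safe (X at s) (s≢2 , s≢3) = InG-turn X (lem s s≢2 s≢3)
    where
    lem : ∀ s → s ≢ 2F → s ≢ 3F → sp s ≢ opposite (sp s)
    lem 0F _ _ = 0≢last
    lem 1F _ _ = α≢α′
    lem 2F ne _ = ⊥-elim (ne refl)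
    lem 3F _ ne = ⊥-elim (ne refl)
    lem 4F _ _ = mirror α≢α′
    lem 5F _ _ = mirror 0≢last

  InG-run : ∀ {w} → All Safe w → InG n (run w)
  InG-run []             = InG-id
  InG-run {l ∷ w} (s ∷ ss) = InG-∘ (InG-safe l s) (InG-run ss)

  Safe-inverse : ∀ {w} → All Safe w → All Safe (inverseWord w)
  Safe-inverse [] = []
  Safe-inverse {(X at s) ∷ w} (p ∷ ps) = ++⁺ (Safe-inverse ps) (p ∷ [])

  InG-++ : ∀ v w → InG n (run v) → InG n (run w) → InG n (run (v ++ w))
  InG-++ v w v∈G w∈G = InG-≗ (run-++ v w) (InG-∘ v∈G w∈G)

  -- Only the conjugate has to lie in the group, not the turn of `β` itself. If `β` is the middle,
  -- all slices other than `β` can be turned, and `e` replaces the conjugate by one that uses them.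
  InG-conjugate-β : (A A′ : Face) → (∀ u v f →
       runC true u v (L at 2F ∷ A at 1F ∷ R at 2F ∷ []) (faceLabel f) ≡
       runC true u v (R off 2F ∷ A′ at 4F ∷ L off 2F ∷ []) (faceLabel f)) →
    InG n (run (L at 2F ∷ A at 1F ∷ R at 2F ∷ []))
  InG-conjugate-β A A′ e = by-cases (β ≟ opposite β)
    where
    by-cases : Dec (β ≡ opposite β) → InG n (run (L at 2F ∷ A at 1F ∷ R at 2F ∷ []))
    by-cases (no β≢β′) = InG-∘ (InG-turn L β≢β′) (InG-∘ (InG-safe (A at 1F) ((λ ()) , λ ())) (InG-turn R β≢β′))
    by-cases (yes β≡β′) = InG-≗
      (run-by-classes (L at 2F ∷ A at 1F ∷ R at 2F ∷ []) (R off 2F ∷ A′ at 4F ∷ L off 2F ∷ [])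
        (subst (λ b → ∀ u v f → runC b u v (L at 2F ∷ A at 1F ∷ R at 2F ∷ []) (faceLabel f) ≡
                                runC b u v (R off 2F ∷ A′ at 4F ∷ L off 2F ∷ []) (faceLabel f)) (sym (≡⇒== β≡β′)) e))
      (InG-∘ (others R) (InG-∘ (InG-safe (A′ at 4F) ((λ ()) , λ ())) (others L)))
      where
      others : ∀ X → InG n (turnOn X (letterSlices (X off 2F)))
      others X = InG-turnOn X (letterSlices (X off 2F)) λ s≠β s≡s′ →
        contradiction (trans (sym s≠β) (cong not (≡⇒== (middle-unique s≡s′ β≡β′)))) λ ()

  -- The word is bracketed so that the slice `β` occurs only in conjugates of a turn of `α` and of
  -- its inverse.
  InG-threeCycle : InG n (run threeCycle)
  InG-threeCycle = subst (λ w → InG n (run w)) parts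
    (InG-++ w₁ (w₂ ++ w₃ ++ w₄) (InG-conjugate-β B U conjugate-middle)
    (InG-++ w₂ (w₃ ++ w₄) (InG-run {w₂} (((λ ()) , λ ()) ∷ ((λ ()) , λ ()) ∷ ((λ ()) , λ ()) ∷ []))
    (InG-++ w₃ w₄ (InG-conjugate-β F D conjugate-middle⁻¹) (InG-run {w₄} (((λ ()) , λ ()) ∷ [])))))
    where
    w₁ w₂ w₃ w₄ : List Letter
    w₁ = L at 2F ∷ B at 1F ∷ R at 2F ∷ []
    w₂ = F at 1F ∷ U at 5F ∷ B at 1F ∷ []
    w₃ = L at 2F ∷ F at 1F ∷ R at 2F ∷ []
    w₄ = D at 5F ∷ []
    parts : w₁ ++ w₂ ++ w₃ ++ w₄ ≡ threeCycle
    parts = refl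

  -- Realising the even permutations of the orbit

  record Realised (h : Fin 24 → Fin 24) : Set where
    constructor realised
    field
      element   : Facelet n → Facelet n
      element∈G : InG n element
      fixes     : ∀ x → ¬ Orbit x → element x ≡ x
      on-orbit  : ∀ y → element (emb α β y) ≡ emb α β (h y)

  open Realised

  realised-id : Realised id
  realised-id = realised id InG-id (λ _ _ → refl) (λ _ → refl)

  realised-∘ : ∀ {h k} → Realised h → Realised k → Realised (h ∘ k)
  realised-∘ {k = k} g g′ = realised (element g ∘ element g′) (InG-∘ (element∈G g) (element∈G g′))
    (λ x x∉ → trans (cong (element g) (fixes g′ x x∉)) (fixes g x x∉))
    (λ y → trans (cong (element g) (on-orbit g′ y)) (on-orbit g (k y)))

  realised-≗ : ∀ {h k} → (∀ y → h y ≡ k y) → Realised h → Realised k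
  realised-≗ h≗k g = realised (element g) (element∈G g) (fixes g)
    (λ y → trans (on-orbit g y) (cong (emb α β) (h≗k y)))

  -- Conjugation keeps the outside of the orbit fixed because `w` maps the orbit into itself: a
  -- facelet brought into it by the inverse word must have come from it.
  realised-conjugate : ∀ w t → All Safe w → InG n (run t) → (∀ x → ¬ Orbit x → run t x ≡ x) →
    Realised (runC mid (just 1F) (just 2F) (w ++ t ++ inverseWord w))
  realised-conjugate w t w-safe t∈G t-fix = realised
    (run (w ++ t ++ inverseWord w))
    (InG-++ w (t ++ inverseWord w) (InG-run w-safe) (InG-++ t (inverseWord w) t∈G (InG-run (Safe-inverse w-safe))))
    (λ x x∉ → trans (run-++ w (t ++ inverseWord w) x) (trans (cong (run w) (run-++ t (inverseWord w) x))
      (trans (cong (run w) (t-fix (run (inverseWord w) x) (outside x x∉))) (run-inverse w x))))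
    (run-orbit (w ++ t ++ inverseWord w))
    where
    outside : ∀ x → ¬ Orbit x → ¬ Orbit (run (inverseWord w) x)
    outside x x∉ (y , e) = x∉ (runC mid (just 1F) (just 2F) w y , trans (sym (run-orbit w y)) (trans (cong (run w) e) (run-inverse w x)))

  realised-cycle₀₈ : ∀ x → x ≢ 0F → Realised (cycle₀₈ x)
  realised-cycle₀₈ x x≢0 = by-cases (x ≟ 8F)
    where
    by-cases : Dec (x ≡ 8F) → Realised (cycle₀₈ x)
    by-cases (yes x≡8) = realised-≗
      (λ y → sym (trans (cong (λ z → cycle₀₈ z y) x≡8) (transpose-involutive 0F 8F y))) realised-id
    by-cases (no x≢8) = realised-≗ (conjugated-cycle mid x x≢0 x≢8)
      (realised-conjugate (lookup conjugators x) threeCycle (conjugators-safe x) InG-threeCycle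
        (run-outside threeCycle (threeCycle-fixes mid)))

  realised-stars : ∀ xs → All (_≢ 0F) xs → odd (length xs) ≡ false → Realised (applyStars xs)
  realised-stars []           _                  _ = realised-id
  realised-stars (x ∷ [])     _                  ()
  realised-stars (x ∷ y ∷ xs) (x≢0 ∷ y≢0 ∷ xs≢0) e = realised-≗ pair
    -- (0 x)(0 8) followed on the right by the square (0 8)(0 y) leaves (0 x)(0 y).
    (realised-∘ (realised-cycle₀₈ x x≢0) (realised-∘ (realised-cycle₀₈ y y≢0) (realised-∘ (realised-cycle₀₈ y y≢0)
      (realised-stars xs xs≢0 (trans (sym (not-involutive _)) e)))))
    where
    pair : ∀ z → cycle₀₈ x (cycle₀₈ y (cycle₀₈ y (applyStars xs z))) ≡ applyStars (x ∷ y ∷ xs) z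
    pair z = trans (cong (cycle₀₈ x) (cycle₀₈-square y y≢0 (applyStars xs z)))
                   (cong (transpose 0F x ⟨$⟩ʳ_) (transpose-involutive 0F 8F (applyStars (y ∷ xs) z)))

  realised-even : ∀ ts → odd (length ts) ≡ false → Realised (applyTranspositions ts)
  realised-even ts e = let xs , xs≢0 , xs-odd , ts≗xs = toStars ts in
    realised-≗ (sym ∘ ts≗xs) (realised-stars xs xs≢0 (trans xs-odd e))

  -- Evenness and the isomorphism

  -- A border facelet has 0 or the last coordinate as its row or column, and no facelet of the orbit
  -- does. Elements of the subgroup therefore fix the border, as `fixes-border⇒even` asks.
  border∉Orbit : ∀ p y → ¬ Orbit (emb fzero p y)
  border∉Orbit p y (z , e) = lem (proj₂ (remQuot {6} 4 y)) (proj₂ (remQuot {6} 4 z))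
    (cong (proj₁ ∘ proj₂) e) (cong (proj₂ ∘ proj₂) e)
    where
    inner : ∀ t → (fzero ≢ sp (proj₁ (corner t)) × sp (proj₁ (corner t)) ≢ fromℕ m) ×
                  (fzero ≢ sp (proj₂ (corner t)) × sp (proj₂ (corner t)) ≢ fromℕ m)
    inner 0F = (0≢α , α≢last) , (0≢β , β≢last)
    inner 1F = (0≢β , β≢last) , (0≢α′ , α′≢last)
    inner 2F = (0≢α′ , α′≢last) , (0≢β′ , β′≢last)
    inner 3F = (0≢β′ , β′≢last) , (0≢α , α≢last)
    lem : ∀ t s → sp (proj₁ (corner s)) ≡ coord fzero p (proj₁ (corner t)) →
          sp (proj₂ (corner s)) ≡ coord fzero p (proj₂ (corner t)) → ⊥
    lem 0F s e _ = proj₁ (proj₁ (inner s)) (sym e)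
    lem 1F s _ e = proj₂ (proj₂ (inner s)) e
    lem 2F s e _ = proj₂ (proj₁ (inner s)) e
    lem 3F s _ e = proj₁ (proj₂ (inner s)) (sym e)

  Orbit? : ∀ x → Dec (Orbit x)
  Orbit? x = any? λ y → ≡-dec _≟ᶠ_ (≡-dec _≟_ _≟_) (emb α β y) x

  Fixes : (Facelet n → Facelet n) → Set
  Fixes g = ∀ x → ¬ Orbit x → g x ≡ x

  -- `Ψ` is read from the word that witnesses membership. Independence of this word and the
  -- homomorphism law follow from `Ψ-emb`, since `emb α β` is injective.
  isoToA24 : ∀ {P : (Facelet n → Facelet n) → Set} →
    (∀ {g} → P g → InG n g × Fixes g) → (∀ {g} → InG n g × Fixes g → P g) → IsoToA24 n P
  isoToA24 {P} out into = record
    { Ψ      = Ψ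
    ; Ψ-cong = λ g h pg ph g≗h y → emb-inj (trans (sym (Ψ-emb pg y)) (trans (g≗h _) (Ψ-emb ph y)))
    ; Ψ-hom  = λ g h pg ph pgh y → emb-inj (trans (sym (Ψ-emb pgh y)) (trans (cong g (Ψ-emb ph y)) (Ψ-emb pg _)))
    ; Ψ-inj  = Ψ-inj
    ; Ψ-even = λ g pg → ts pg , even⇒double _ (ts-even pg) , toPerm-apply (ts pg)
    ; Ψ-onto = Ψ-onto
    }
    where
    emb-inj : ∀ {y z} → emb α β y ≡ emb α β z → y ≡ z
    emb-inj = emb-injective β α≢α′ _ _
    word : ∀ {g} → P g → List (Move n)
    word = proj₁ ∘ proj₁ ∘ out
    ts : ∀ {g} → P g → List Transposition
    ts pg = wordTs α β (word pg)
    Ψ : ∀ g → P g → Permutation′ 24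
    Ψ g pg = toPerm (ts pg)
    Ψ-emb : ∀ {g} (pg : P g) y → g (emb α β y) ≡ emb α β (Ψ g pg ⟨$⟩ʳ y)
    Ψ-emb pg y = trans (proj₂ (proj₁ (out pg)) (emb α β y))
      (trans (applyWord-emb α β (word pg) y) (cong (emb α β) (sym (toPerm-apply (ts pg) y))))
    ts-even : ∀ {g} (pg : P g) → odd (length (ts pg)) ≡ false
    ts-even pg = fixes-border⇒even {w = word pg} α β 0≢last λ p y →
      trans (sym (proj₂ (proj₁ (out pg)) _)) (proj₂ (out pg) _ (border∉Orbit p y))
    Ψ-inj : ∀ g h (pg : P g) (ph : P h) → (∀ y → Ψ g pg ⟨$⟩ʳ y ≡ Ψ h ph ⟨$⟩ʳ y) → ∀ x → g x ≡ h x
    Ψ-inj g h pg ph e x = by-cases (Orbit? x)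
      where
      by-cases : Dec (Orbit x) → g x ≡ h x
      by-cases (yes (y , y≡x)) = subst (λ x → g x ≡ h x) y≡x
        (trans (Ψ-emb pg y) (trans (cong (emb α β) (e y)) (sym (Ψ-emb ph y))))
      by-cases (no x∉) = trans (proj₂ (out pg) x x∉) (sym (proj₂ (out ph) x x∉))
    Ψ-onto : ∀ π → IsEven π → ∃ λ g → Σ (P g) λ pg → ∀ y → Ψ g pg ⟨$⟩ʳ y ≡ π ⟨$⟩ʳ y
    Ψ-onto π (us , (k , us-length) , π≗us) = g , pg , λ y →
      emb-inj (trans (sym (Ψ-emb pg y)) (trans (on-orbit real y) (cong (emb α β) (sym (π≗us y)))))
      where
      real : Realised (applyTranspositions us)
      real = realised-even us (trans (cong odd us-length) (odd-double k))
      g : Facelet n → Facelet n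
      g = element real
      pg : P g
      pg = into (element∈G real , fixes real)

-- The orbit `(i , j)` in terms of zero-based coordinates

theorem13 : (n i j : ℕ) → 5 ≤ n → 2 ≤ i → i ≤ ⌊ n /2⌋ → 2 ≤ j → j ≤ ⌈ n /2⌉ → j ≢ i →
    IsoToA24 n (InZ n i j)
theorem13 (suc (suc l)) (suc i) (suc j) 5≤n (s≤s 1≤i) i≤ (s≤s 1≤j) j≤ j≢i =
  isoToA24 generic
    (λ (g∈G , g-fix) → g∈G , λ x x∉ → g-fix x (x∉ ∘ InOrbit⇒Orbit x))
    (λ (g∈G , g-fix) → g∈G , λ x x∉ → g-fix x (x∉ ∘ Orbit⇒InOrbit x))
  where
  m n : ℕ
  m = suc l
  n = suc m

  i<n : suc i < n
  i<n = ≤-trans (s≤s i≤) (⌊n/2⌋<n m)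
  j<n : suc j < n
  j<n = ≤-trans (s≤s j≤) (⌈n/2⌉<n l)

  -- After the pattern matching `i` and `j` are already zero-based.
  α β : Fin n
  α = fromℕ< (<⇒≤ i<n)
  β = fromℕ< (<⇒≤ j<n)

  toℕ-α : toℕ α ≡ i
  toℕ-α = toℕ-fromℕ< (<⇒≤ i<n)
  toℕ-β : toℕ β ≡ j
  toℕ-β = toℕ-fromℕ< (<⇒≤ j<n)

  -- For the one-based index `suc k`, the expression `suc n ∸ suc k` of `InOrbit` computes to
  -- `n ∸ k`.
  toℕ-mirror : ∀ p {k} → toℕ p ≡ k → suc k < n → suc (toℕ (opposite p)) ≡ n ∸ k
  toℕ-mirror p refl k<n = trans (cong suc (opposite-prop p)) (sym (+-∸-assoc 1 (<⇒≤ (s≤s⁻¹ k<n))))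

  α′ : suc (toℕ (opposite α)) ≡ n ∸ i
  α′ = toℕ-mirror α toℕ-α i<n
  β′ : suc (toℕ (opposite β)) ≡ n ∸ j
  β′ = toℕ-mirror β toℕ-β j<n

  0≢ : ∀ {p : Fin n} {k} → toℕ p ≡ k → 1 ≤ k → fzero ≢ p
  0≢ refl 1≤0 refl with () ← 1≤0

  0≢mirror : ∀ {p : Fin n} {k} → toℕ p ≡ k → suc k < n → fzero ≢ opposite p
  0≢mirror {p} refl k<n 0≡p′ = <-irrefl
    (trans (+-comm 1 (toℕ p)) (trans (cong (λ q → toℕ p + suc (toℕ q)) 0≡p′) (toℕ-opposite p))) k<n

  -- The coordinates of a facelet and its mirror image add up to n - 1, which is
  -- more than i + k for k ≤ ⌈ n /2⌉ - 1.
  α≢mirror : ∀ {p : Fin n} {k} → toℕ p ≡ k → suc k ≤ ⌈ n /2⌉ → α ≢ opposite p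
  α≢mirror {p} refl k≤ α≡p′ = <-irrefl refl (≤-trans
    (≤-reflexive (cong suc (trans (sym (toℕ-opposite p)) (trans (cong (λ q → toℕ p + suc (toℕ q)) (sym α≡p′))
      (trans (cong (λ k → toℕ p + suc k) toℕ-α) (+-comm (toℕ p) (suc i)))))))
    (≤-trans (≤-reflexive (cong suc (sym (+-suc i (toℕ p)))))
    (≤-trans (+-mono-≤ i≤ k≤) (≤-reflexive (⌊n/2⌋+⌈n/2⌉≡n n)))))

  generic : Generic α β
  generic = record
    { 0≢last = λ ()
    ; 0≢α    = 0≢ toℕ-α 1≤i
    ; 0≢β    = 0≢ toℕ-β 1≤j
    ; 0≢α′   = 0≢mirror toℕ-α i<n
    ; 0≢β′   = 0≢mirror toℕ-β j<n
    ; α≢α′   = α≢mirror toℕ-α (≤-trans i≤ (⌊n/2⌋≤⌈n/2⌉ n))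
    ; α≢β    = λ α≡β → j≢i (cong suc (trans (sym toℕ-β) (trans (cong toℕ (sym α≡β)) toℕ-α)))
    ; α≢β′   = α≢mirror toℕ-β j≤
    }

  InOrbit⇒Orbit : ∀ x → InOrbit n (suc i) (suc j) x → Orbit generic x
  InOrbit⇒Orbit (f , r , c) = λ
    { (inj₁ (r≡ , c≡)) →
        at-corner 0F (trans r≡ (cong suc (sym toℕ-α))) (trans c≡ (cong suc (sym toℕ-β)))
    ; (inj₂ (inj₁ (r≡ , c≡)))        → at-corner 1F (trans r≡ (cong suc (sym toℕ-β))) (trans c≡ (sym α′))
    ; (inj₂ (inj₂ (inj₁ (r≡ , c≡)))) → at-corner 2F (trans r≡ (sym α′)) (trans c≡ (sym β′))
    ; (inj₂ (inj₂ (inj₂ (r≡ , c≡)))) → at-corner 3F (trans r≡ (sym β′)) (trans c≡ (cong suc (sym toℕ-α)))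
    }
    where
    at-corner : ∀ t → suc (toℕ r) ≡ suc (toℕ (coord α β (proj₁ (corner t)))) →
                suc (toℕ c) ≡ suc (toℕ (coord α β (proj₂ (corner t)))) → Orbit generic (f , r , c)
    at-corner t r≡ c≡ = subst (Orbit generic) (cong (f ,_) (cong₂ _,_
      (sym (toℕ-injective (suc-injective r≡))) (sym (toℕ-injective (suc-injective c≡))))) (orbit-corner generic f t)

  Orbit⇒InOrbit : ∀ x → Orbit generic x → InOrbit n (suc i) (suc j) x
  Orbit⇒InOrbit x (y , y≡x) = subst (InOrbit n (suc i) (suc j)) y≡x
    (at-corner (faceAt (proj₁ (remQuot {6} 4 y))) (proj₂ (remQuot {6} 4 y)))
    where
    at-corner : ∀ f t →
      InOrbit n (suc i) (suc j) (f , coord α β (proj₁ (corner t)) , coord α β (proj₂ (corner t)))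
    at-corner f 0F = inj₁ (cong suc toℕ-α , cong suc toℕ-β)
    at-corner f 1F = inj₂ (inj₁ (cong suc toℕ-β , α′))
    at-corner f 2F = inj₂ (inj₂ (inj₁ (α′ , β′)))
    at-corner f 3F = inj₂ (inj₂ (inj₂ (β′ , cong suc toℕ-α)))
theorem13 (suc zero) _ _ (s≤s ())
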